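{- The following is provable in $\mathrm{BZFC}$: for every set $A$, $$|A|=|A_{\mathbf t}|+|A_{\mathbf b}|\cdot\mathfrak b+|A_{\mathbf n}|\cdot\mathfrak n.$$
   Context: Logic. The background logic is the four-valued first-order logic BS4 with primitives $\sim,\land,\lor,\rightarrow,\leftrightarrow,\bot,\forall,\exists$. A model has a non-empty domain $M$, the usual interpretations of constants and function symbols, and, for each $n$-ary relation symbol $R$, two independent interpretations $R^+,R^-\subseteq M^n$; $=^+$ is true identity and $=^-$ is a symmetric relation. Truth and falsity are defined simultaneously (a formula may be true, false, both, or neither): an atomic formula is true/false according to $R^+$/$R^-$; $\sim\varphi$ is true iff $\varphi$ is false, and false iff $\varphi$ is true; $\varphi\land\psi$ is true iff both are true, false iff at least one is false; $\lor$ dually; $\varphi\rightarrow\psi$ is true iff ($\varphi$ true implies $\psi$ true), false iff $\varphi$ is true and $\psi$ is false; $\varphi\leftrightarrow\psi$ is true iff ($\varphi$ true iff $\psi$ true), false iff ($\varphi$ true and $\psi$ false) or ($\varphi$ false and $\psi$ true); $\forall$ is true iff all instances are true, false iff some instance is false; $\exists$ is true iff some instance is true, false iff all instances are false; $\bot$ is false and not true. $\Gamma\vDash\varphi$ iff $\varphi$ is true in every model in which all of $\Gamma$ is true. Asserting a formula means asserting that it is true; English "iff", "if/then", "and", "or" between formulas concern truth. Abbreviations: $\neg\varphi:=\varphi\rightarrow\bot$ (true iff $\varphi$ is not true); $!\varphi:=\sim\neg\varphi$ (two-valued, true iff $\varphi$ is true); $?\varphi:=\neg\sim\varphi$ (two-valued,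 true iff $\varphi$ is not false); $\circ\varphi:=\,!\varphi\leftrightarrow ?\varphi$; $\varphi\Rightarrow\psi:=(\varphi\rightarrow\psi)\land(\sim\psi\rightarrow\sim\varphi)$; $\varphi\Leftrightarrow\psi:=(\varphi\leftrightarrow\psi)\land(\sim\varphi\leftrightarrow\sim\psi)$; $\varphi\,\&\,\psi:=\,\sim(\varphi\rightarrow\sim\psi)$; $\exists x\in A\,\varphi:=\exists x(x\in A\,\&\,\varphi)$; $\forall x\in A\,\varphi:=\forall x(x\in A\rightarrow\varphi)$. A slashed relation symbol is the $\sim$-negation of the relation. Set theory. $\mathrm{BZFC}$ is a BS4-theory in the language $\{\in,=\}$ whose objects are called sets. It includes: Extensionality $\forall A\forall B(A=B\Leftrightarrow\forall x(x\in A\Leftrightarrow x\in B))$; Comprehension $\forall A\exists B\forall x(x\in B\Leftrightarrow x\in A\land\varphi(x))$; ACLA: $\exists A(A^!\not\subseteq A^?)\land\exists A(A^?\not\subseteq A^!)$; Choice: every classical set of non-empty sets has a choice function. Here $A=\{x:\varphi(x)\}$ means $\forall x(x\in A\Leftrightarrow\varphi(x))$; $A\subseteq B:=\forall x(x\in A\Rightarrow x\in B)$; $A$ is classical if $\forall x\,{\circ}(x\in A)$; $A^!:=\{x:{!}(x\in A)\}$ and $A^?:=\{x:{?}(x\in A)\}$. The remaining axioms are suitable analogues of those of $\mathrm{ZFC}$; available consequences are: $A^!,A^?$ are (classical) sets; $A\subseteq B\leftrightarrow(A^!\subseteq B^!\land A^?\subseteq B^?)$, $A\not\subseteq B\leftrightarrow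 A^!\not\subseteq B^?$, $A=B\leftrightarrow(A^!=B^!\land A^?=B^?)$, $A\neq B\leftrightarrow(A^!\not\subseteq B^?\lor B^!\not\subseteq A^?)$; for all classical sets $X,Y$ there is a unique set $\langle X|Y\rangle$ with $\langle X|Y\rangle^!=X$, $\langle X|Y\rangle^?=Y$; ordered pairs (and triples) are encoded so that $(a,b)=(c,d)\Leftrightarrow(a=c\land b=d)$; usual $\mathrm{ZFC}$ set theory (including choice and von Neumann ordinals, which live in the inner $\mathrm{ZFC}$-model of hereditarily classical sets) applies to classical sets, whose elements may be arbitrary sets. For a classical set $X$, $|X|_{Cl}$ is the least von Neumann ordinal in bijection with $X$. Put $A_{\mathbf b}:=A^!\setminus A^?$, $A_{\mathbf t}:=A^!\cap A^?$, $A_{\mathbf n}:=A^?\setminus A^!$, $\mathrm{rlm}(A):=A^!\cup A^?$ (all classical sets). For pairwise disjoint classical $X,Y,Z$, $\langle X|Y|Z\rangle$ is the unique set $A$ with $A_{\mathbf b}=X$, $A_{\mathbf t}=Y$, $A_{\mathbf n}=Z$. $\emptyset=\{x:\bot\}$, and $\{a\}$ is the classical set $\{x:{!}(x=a)\}$. Cardinal numbers. The cardinal number of $A$ is the triple $|A|:=(X,Y,Z)$ with $$X:=\big\langle |A^!|_{Cl}\,\big|\,|A^?|_{Cl}\big\rangle,\quad Y:=\big\langle |A_{\mathbf t}|_{Cl}\,\big|\,|A^?|_{Cl}\big\rangle,\quad Z:=\big\langle |A_{\mathbf b}|_{Cl}\,\big|\,|A_{\mathbf n}|_{Cl}\big\rangle.$$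 Cardinal numbers are the elements of $\{|x|:x\text{ a set}\}$. Arithmetic: $|A|+|B|:=|A\uplus B|$ and $|A|\cdot|B|:=|A\times B|$, where $A\times B:=\{(x,y):x\in A\land y\in B\}$ (so $(a,b)\in A\times B\Leftrightarrow a\in A\land b\in B$) and $A\uplus B:=\{(x,0):x\in A\}\cup\{(x,1):x\in B\}$ (so $(a,0)\in A\uplus B\Leftrightarrow a\in A$ and $(b,1)\in A\uplus B\Leftrightarrow b\in B$). Finally $\mathfrak b:=|\langle\{\emptyset\}|\emptyset|\emptyset\rangle|$ and $\mathfrak n:=|\langle\emptyset|\emptyset|\{\emptyset\}\rangle|$. -}

module Defs where

open import Level using (Level) renaming (suc to lsuc)
open import Data.Nat.Base using (ℕ; zero; suc)
open import Data.Fin.Base using (Fin; zero; suc; lift)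
open import Data.Vec.Base using (Vec; []; _∷_; lookup)
open import Data.Product.Base using (Σ; _×_)
open import Data.Sum.Base using (_⊎_)
open import Data.Empty.Polymorphic using (⊥)
open import Data.Unit.Polymorphic using (⊤)
open import Relation.Binary.PropositionalEquality.Core using (_≡_)

private variable
  m n : ℕ

infix  8 _∈ᵛ_ _=ᵛ_
infixr 7 ∼_ ¬_ !_ ¿_ ∘_
infixr 6 _∧_ _&_
infixr 5 _∨_
infixr 4 _⟶_ _⟷_ _⇒_ _⇔_

------------------------------------------------------------------------
-- BS4 over the language {∈, =}

-- Form n: formulas with n free variables (de Bruijn indices; index zero is
-- the innermost variable).
data Form : ℕ → Set where
  _∈ᵛ_ _=ᵛ_           : Fin n → Fin n → Form n
  ⊥ᶠ                  : Form n
  ∼_                  : Form n → Form n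
  _∧_ _∨_ _⟶_ _⟷_    : Form n → Form n → Form n
  ∀ᶠ ∃ᶠ               : Form (suc n) → Form n

Sentence : Set
Sentence = Form 0

record Model (ℓ : Level) : Set (lsuc ℓ) where
  field
    Dom     : Set ℓ
    point   : Dom
    _∈⁺_    : Dom → Dom → Set ℓ
    _∈⁻_    : Dom → Dom → Set ℓ
    _=⁻_    : Dom → Dom → Set ℓ
    =⁻-sym  : ∀ {x y} → x =⁻ y → y =⁻ x

module Semantics {ℓ : Level} (𝔐 : Model ℓ) where
  open Model 𝔐

  True False : Form n → Vec Dom n → Set ℓ

  True (i ∈ᵛ j)  ρ = lookup ρ i ∈⁺ lookup ρ j
  True (i =ᵛ j)  ρ = lookup ρ i ≡ lookup ρ j
  True ⊥ᶠ        ρ = ⊥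
  True (∼ φ)     ρ = False φ ρ
  True (φ ∧ ψ)   ρ = True φ ρ × True ψ ρ
  True (φ ∨ ψ)   ρ = True φ ρ ⊎ True ψ ρ
  True (φ ⟶ ψ)   ρ = True φ ρ → True ψ ρ
  True (φ ⟷ ψ)   ρ = (True φ ρ → True ψ ρ) × (True ψ ρ → True φ ρ)
  True (∀ᶠ φ)    ρ = ∀ x → True φ (x ∷ ρ)
  True (∃ᶠ φ)    ρ = Σ Dom λ x → True φ (x ∷ ρ)

  False (i ∈ᵛ j) ρ = lookup ρ i ∈⁻ lookup ρ j
  False (i =ᵛ j) ρ = lookup ρ i =⁻ lookup ρ j
  False ⊥ᶠ       ρ = ⊤
  False (∼ φ)    ρ = True φ ρ
  False (φ ∧ ψ)  ρ = False φ ρ ⊎ False ψ ρ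
  False (φ ∨ ψ)  ρ = False φ ρ × False ψ ρ
  False (φ ⟶ ψ)  ρ = True φ ρ × False ψ ρ
  False (φ ⟷ ψ)  ρ = (True φ ρ × False ψ ρ) ⊎ (False φ ρ × True ψ ρ)
  False (∀ᶠ φ)   ρ = Σ Dom λ x → False φ (x ∷ ρ)
  False (∃ᶠ φ)   ρ = ∀ x → False φ (x ∷ ρ)

Theory : Set₁
Theory = Sentence → Set

_⊩_ : ∀ {ℓ} → Model ℓ → Sentence → Set ℓ
𝔐 ⊩ φ = Semantics.True 𝔐 φ []

-- Semantic consequence, over the models whose domain lives in Set ℓ.
_⊨[_]_ : Theory → (ℓ : Level) → Sentence → Set (lsuc ℓ)
Γ ⊨[ ℓ ] φ = (𝔐 : Model ℓ) → (∀ γ → Γ γ → 𝔐 ⊩ γ) → 𝔐 ⊩ φ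

------------------------------------------------------------------------
-- Derived connectives

¬_ !_ ¿_ ∘_ : Form n → Form n
¬ φ = φ ⟶ ⊥ᶠ
! φ = ∼ ¬ φ
-- ¿ is written "?" on paper, which Agda reserves for holes.
¿ φ = ¬ ∼ φ
∘ φ = ! φ ⟷ ¿ φ

_⇒_ _⇔_ _&_ : Form n → Form n → Form n
φ ⇒ ψ = (φ ⟶ ψ) ∧ (∼ ψ ⟶ ∼ φ)
φ ⇔ ψ = (φ ⟷ ψ) ∧ (∼ φ ⟷ ∼ ψ)
φ & ψ = ∼ (φ ⟶ ∼ ψ)

ren : (Fin m → Fin n) → Form m → Form n
ren σ (i ∈ᵛ j)  = σ i ∈ᵛ σ j
ren σ (i =ᵛ j)  = σ i =ᵛ σ j
ren σ ⊥ᶠ        = ⊥ᶠ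
ren σ (∼ φ)     = ∼ ren σ φ
ren σ (φ ∧ ψ)   = ren σ φ ∧ ren σ ψ
ren σ (φ ∨ ψ)   = ren σ φ ∨ ren σ ψ
ren σ (φ ⟶ ψ)   = ren σ φ ⟶ ren σ ψ
ren σ (φ ⟷ ψ)   = ren σ φ ⟷ ren σ ψ
ren σ (∀ᶠ φ)    = ∀ᶠ (ren (lift 1 σ) φ)
ren σ (∃ᶠ φ)    = ∃ᶠ (ren (lift 1 σ) φ)

-- Universal closure.
closure : Form n → Sentence
closure {zero}  φ = φ
closure {suc n} φ = closure (∀ᶠ φ)

------------------------------------------------------------------------
-- Class terms

-- The language has no function symbols, so a defined term is given by its
-- graph: a formula in which variable zero stands for the value of the term
-- and the variables suc i are the free variables of the term.
Term : ℕ → Set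
Term n = Form (suc n)

infix 20 _↑

-- Weakening of a term: the value stays at zero, a fresh variable is inserted
-- right after it.
_↑ : Term n → Term (suc n)
_↑ = ren (lift 1 suc)

v : Fin n → Term n
v i = zero =ᵛ suc i

v₀ : Term (suc n)
v₀ = v zero

v₁ : Term (suc (suc n))
v₁ = v (suc zero)

v₂ : Term (suc (suc (suc n)))
v₂ = v (suc (suc zero))

-- "let x = t in φ(x)".  Since & only looks at the truth of its left argument,
-- this has both the truth and the falsity conditions of φ at the value of t.
bind : Term n → Form (suc n) → Form n
bind t φ = ∃ᶠ (t & φ)

infix 8 _∈_ _≐_ _⊆_

_∈_ _≐_ : Term n → Term n → Form n
s ∈ t = bind s (bind (t ↑) (suc zero ∈ᵛ zero))
s ≐ t = bind s (bind (t ↑) (suc zero =ᵛ zero))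

∀∈ ∃∈ : Term n → Form (suc n) → Form n
∀∈ t φ = ∀ᶠ (v₀ ∈ t ↑ ⟶ φ)
∃∈ t φ = ∃ᶠ (v₀ ∈ t ↑ & φ)

-- Exactly one x makes φ(x) true.
∃! : Form (suc n) → Form n
∃! φ = ∃ᶠ (∀ᶠ (φ ↑ ⟷ zero =ᵛ suc zero))

-- Equality of definite descriptions in Russell's sense: some κ is the one and
-- only value of s, and also the one and only value of t.
infix 3 _≗_
_≗_ : Term n → Term n → Form n
s ≗ t = ∃ᶠ (∀ᶠ (s ↑ ⟷ zero =ᵛ suc zero) ∧ ∀ᶠ (t ↑ ⟷ zero =ᵛ suc zero))

-- {x : φ(x)}
｛_｝ : Form (suc n) → Term n
｛ φ ｝ = ∀ᶠ (zero ∈ᵛ suc zero ⇔ φ ↑)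

------------------------------------------------------------------------
-- Basic set theory

_⊆_ : Term n → Term n → Form n
A ⊆ B = ∀ᶠ (v₀ ∈ A ↑ ⇒ v₀ ∈ B ↑)

Classical : Term n → Form n
Classical A = ∀ᶠ (∘ (v₀ ∈ A ↑))

infix 18 _^! _^? _ᵇ _ᵗ _ⁿ
_^! _^? : Term n → Term n
A ^! = ｛ ! (v₀ ∈ A ↑) ｝
A ^? = ｛ ¿ (v₀ ∈ A ↑) ｝

infixl 12 _∪_ _∩_ _∖_
_∪_ _∩_ _∖_ : Term n → Term n → Term n
A ∪ B = ｛ v₀ ∈ A ↑ ∨ v₀ ∈ B ↑ ｝
A ∩ B = ｛ v₀ ∈ A ↑ ∧ v₀ ∈ B ↑ ｝
A ∖ B = ｛ v₀ ∈ A ↑ ∧ ∼ (v₀ ∈ B ↑) ｝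

_ᵇ _ᵗ _ⁿ rlm : Term n → Term n
A ᵇ   = A ^! ∖ A ^?
A ᵗ   = A ^! ∩ A ^?
A ⁿ   = A ^? ∖ A ^!
rlm A = A ^! ∪ A ^?

⟨_¦_⟩ : Term n → Term n → Term n
⟨ X ¦ Y ⟩ = v₀ ^! ≐ X ↑ ∧ v₀ ^? ≐ Y ↑

⟨_¦_¦_⟩ : Term n → Term n → Term n → Term n
⟨ X ¦ Y ¦ Z ⟩ = v₀ ᵇ ≐ X ↑ ∧ v₀ ᵗ ≐ Y ↑ ∧ v₀ ⁿ ≐ Z ↑

∅ : Term n
∅ = ｛ ⊥ᶠ ｝

sing : Term n → Term n
sing a = ｛ ! (v₀ ≐ a ↑) ｝

0ˢ 1ˢ : Term n
0ˢ = ∅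
1ˢ = sing ∅

-- The Kuratowski pair of a and b.  It is always classical, so it does not
-- satisfy (a,b) = (c,d) ⇔ (a = c ∧ b = d) on the falsity side.  It only serves
-- to tag elements in the ordered pair below.
kpair : Term n → Term n → Term n
kpair a b = sing (sing a) ∪ sing (sing a ∪ sing b)

-- (a,b) is the tagged union of a and b.  Membership in a and in b is copied
-- with both its truth and its falsity, whence (a,b) = (c,d) ⇔ (a = c ∧ b = d).
pair : Term n → Term n → Term n
pair a b = ｛ ∃ᶠ (v₁ ≐ kpair v₀ 0ˢ & v₀ ∈ a ↑ ↑)
            ∨ ∃ᶠ (v₁ ≐ kpair v₀ 1ˢ & v₀ ∈ b ↑ ↑) ｝

triple : Term n → Term n → Term n → Term n
triple a b c = pair a (pair b c)

infixl 14 _⊗_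
infixl 12 _⊎ˢ_

-- {(x,y) : φ} is {z : ∃x∃y (z = (x,y) & φ)}: only the truth of z = (x,y)
-- matters.
_⊗_ : Term n → Term n → Term n
A ⊗ B = ｛ ∃ᶠ (∃ᶠ (v₂ ≐ pair v₁ v₀ & (v₁ ∈ A ↑ ↑ ↑ ∧ v₀ ∈ B ↑ ↑ ↑))) ｝

_⊎ˢ_ : Term n → Term n → Term n
A ⊎ˢ B = ｛ ∃ᶠ (v₁ ≐ pair v₀ 0ˢ & v₀ ∈ A ↑ ↑) ｝
       ∪ ｛ ∃ᶠ (v₁ ≐ pair v₀ 1ˢ & v₀ ∈ B ↑ ↑) ｝

FunctionOn : Term n → Term n → Form n
FunctionOn f X =
    Classical f
  ∧ ∀∈ f (∃∈ (X ↑) (∃ᶠ (v₂ ≐ pair v₁ v₀)))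
  ∧ ∀∈ X (∃! (pair v₁ v₀ ∈ f ↑ ↑))

Bijection : Term n → Term n → Term n → Form n
Bijection f X Y =
    Classical f
  ∧ f ⊆ X ⊗ Y
  ∧ ∀∈ X (∃! (pair v₁ v₀ ∈ f ↑ ↑))
  ∧ ∀∈ Y (∃! (pair v₀ v₁ ∈ f ↑ ↑))

infix 8 _≈_
_≈_ : Term n → Term n → Form n
X ≈ Y = ∃ᶠ (Bijection v₀ (X ↑) (Y ↑))

NonEmpty : Term n → Form n
NonEmpty A = ∃ᶠ (v₀ ∈ A ↑)

-- Von Neumann ordinals: hereditarily classical transitive sets that are
-- strictly well-ordered by ∈.
Ordinal : Term n → Form n
Ordinal α =
    Classical α
  ∧ ∀∈ α (Classical v₀)
  ∧ ∀∈ α (v₀ ⊆ α ↑)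
  ∧ ∀∈ α (¬ (v₀ ∈ v₀))
  ∧ ∀∈ α (∀∈ (α ↑) (∀∈ (α ↑ ↑) (v₂ ∈ v₁ ∧ v₁ ∈ v₀ ⟶ v₂ ∈ v₀)))
  ∧ ∀∈ α (∀∈ (α ↑) (v₁ ∈ v₀ ∨ v₁ ≐ v₀ ∨ v₀ ∈ v₁))
  ∧ ∀ᶠ (Classical v₀ ∧ v₀ ⊆ α ↑ ∧ NonEmpty v₀
         ⟶ ∃∈ v₀ (∀∈ v₁ (v₁ ∈ v₀ ∨ v₁ ≐ v₀)))

------------------------------------------------------------------------
-- Cardinal numbers

-- The least ordinal in bijection with X.
∣_∣Cl : Term n → Term n
∣ X ∣Cl = Ordinal v₀ ∧ X ↑ ≈ v₀
        ∧ ∀ᶠ (Ordinal v₀ ∧ X ↑ ↑ ≈ v₀ ⟶ v₁ ∈ v₀ ∨ v₁ ≐ v₀)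

∣_∣ : Term n → Term n
∣ A ∣ = triple ⟨ ∣ A ^! ∣Cl ¦ ∣ A ^? ∣Cl ⟩
               ⟨ ∣ A ᵗ ∣Cl ¦ ∣ A ^? ∣Cl ⟩
               ⟨ ∣ A ᵇ ∣Cl ¦ ∣ A ⁿ ∣Cl ⟩

infixl 10 _⊕_
infixl 11 _⊙_

-- μ is a value of κ ⊕ ν iff κ = |A|, ν = |B| and μ = |A ⊎ B| for some A, B;
-- likewise for ⊙.  Below the two quantifiers v₁ is A, v₀ is B and v₂ is μ.
-- That μ does not depend on A and B is not built in.
_⊕_ _⊙_ : Term n → Term n → Term n
κ ⊕ ν = ∃ᶠ (∃ᶠ (κ ↑ ↑ ↑ ≐ ∣ v₁ ∣ ∧ ν ↑ ↑ ↑ ≐ ∣ v₀ ∣ ∧ v₂ ≐ ∣ v₁ ⊎ˢ v₀ ∣))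
κ ⊙ ν = ∃ᶠ (∃ᶠ (κ ↑ ↑ ↑ ≐ ∣ v₁ ∣ ∧ ν ↑ ↑ ↑ ≐ ∣ v₀ ∣ ∧ v₂ ≐ ∣ v₁ ⊗ v₀ ∣))

𝔟 𝔫 : Term n
𝔟 = ∣ ⟨ sing ∅ ¦ ∅ ¦ ∅ ⟩ ∣
𝔫 = ∣ ⟨ ∅ ¦ ∅ ¦ sing ∅ ⟩ ∣

------------------------------------------------------------------------
-- The theory BZFC

-- In replacement the formula is φ(y, x, A, parameters), listed from variable
-- zero on; under the quantifiers ∀A ∃B ∀y ∃x it has to be read with
-- x at zero, y at one, B (not occurring in φ) at two and A at three.
replacementVars : Fin (suc (suc m)) → Fin (suc (suc (suc m)))
replacementVars zero          = suc zero
replacementVars (suc zero)    = zero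
replacementVars (suc (suc i)) = suc (suc (suc i))

data BZFC : Theory where

  extensionality : BZFC
    (∀ᶠ (∀ᶠ (suc zero =ᵛ zero ⇔ ∀ᶠ (zero ∈ᵛ suc (suc zero) ⇔ zero ∈ᵛ suc zero))))

  -- φ(x, A, parameters)
  comprehension : (φ : Form (suc (suc n))) → BZFC
    (closure (∀ᶠ (∃ᶠ (∀ᶠ
      (zero ∈ᵛ suc zero ⇔ zero ∈ᵛ suc (suc zero) ∧ φ ↑)))))

  classicalSuperset : BZFC
    (∀ᶠ (∃ᶠ (Classical v₀ ∧ v₁ ⊆ v₀)))

  replacement : (φ : Form (suc (suc (suc n)))) → BZFC
    (closure (∀ᶠ
      (Classical v₀ ∧ ∀∈ v₀ (∃! φ)
        ⟶ ∃ᶠ (∀ᶠ (zero ∈ᵛ suc zero ⇔ ∃∈ v₂ (! ren replacementVars φ))))))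

  pairing : BZFC
    (∀ᶠ (∀ᶠ (∃ᶠ (∀ᶠ
      (zero ∈ᵛ suc zero ⇔ ! (v₀ ≐ v (suc (suc (suc zero)))) ∨ ! (v₀ ≐ v₂))))))

  union : BZFC
    (∀ᶠ (∃ᶠ (∀ᶠ (zero ∈ᵛ suc zero
      ⇔ ∃ᶠ (v₀ ∈ v (suc (suc (suc zero))) ∧ v₁ ∈ v₀)))))

  -- The bare {x : x ⊆ A} would be a proper class, since x ⊆ A can fail to be
  -- false however large x^? is.
  powerSet : BZFC
    (∀ᶠ (∃ᶠ (∀ᶠ (zero ∈ᵛ suc zero ⇔ ! (v₀ ⊆ v₂)))))

  infinity : BZFC
    (∃ᶠ (∅ ∈ v₀ ∧ ∀∈ v₀ (v₀ ∪ sing v₀ ∈ v₁)))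

  -- Minimality refers to the realm, so that sets are well-founded with respect
  -- to elements of any status.
  foundation : BZFC
    (∀ᶠ (NonEmpty v₀ ⟶ ∃∈ v₀ (∀∈ v₁ (¬ (v₀ ∈ rlm v₁)))))

  -- A choice function f for X: f(x) ∈ x for all x ∈ X.
  choice : BZFC
    (∀ᶠ (Classical v₀ ∧ ∀∈ v₀ (NonEmpty v₀)
      ⟶ ∃ᶠ (FunctionOn v₀ v₁ ∧ ∀∈ v₁ (∃∈ v₀ (pair v₁ v₀ ∈ v₂)))))

  acla : BZFC
    (∃ᶠ (∼ (v₀ ^! ⊆ v₀ ^?)) ∧ ∃ᶠ (∼ (v₀ ^? ⊆ v₀ ^!)))

-- A BZFC-set is a pair of classical sets, its truths A^! and its possible elements A^?,
-- so |A| = |B| holds iff A_t ≈ B_t, A_b ≈ B_b and A_n ≈ B_n, that is, iff some bijection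
-- between the realms of A and B preserves the status of membership.  Such bijections are
-- compatible with disjoint sums and products, so the right-hand side is the cardinal of
-- (A_t ⊎ A_b × {∅}_b) ⊎ A_n × {∅}_n, where {∅}_b and {∅}_n have ∅ as their only live
-- element.  Conjunction turns "true and both" into "both", and "true and neither" into
-- "neither", so this set is A again up to a status-preserving bijection.
--
-- The cardinals exist by choice: enumerate a classical set X along the ordinals, always
-- picking an element not yet used.  The ordinals so reached form a set O by replacement;
-- were X not exhausted, O itself would be reached and O ∈ O.

module Submission where

open import Axiom.ExcludedMiddle using (ExcludedMiddle)
open import Defs

open import Level using (Level; _⊔_) renaming (suc to lsuc)
open import Data.Nat.Base using (ℕ; zero; suc)
open import Data.Fin.Base using (Fin; zero; suc; lift)
open import Data.Fin.Patterns using (5F; 6F; 7F; 8F)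
open import Data.Vec.Base using (Vec; []; _∷_; lookup; head; tail)
open import Data.Product.Base using (Σ; _×_; _,_; proj₁; proj₂)
import Data.Sum.Base as Sum
open import Data.Sum.Base using (_⊎_; inj₁; inj₂; [_,_]′)
open import Data.Empty.Polymorphic using (⊥; ⊥-elim)
open import Data.Unit.Polymorphic.Base using (⊤; tt)
open import Function.Base using (id)
open import Relation.Nullary.Decidable.Core using (yes; no)
open import Relation.Binary.PropositionalEquality
  using (_≡_; refl; sym; trans; cong; cong₂; subst)

-- Comprehension and replacement accept formulas only, not arbitrary predicates of the metatheory,
-- while a formula such as `∣ t ∣` unfolds to something too large to reason about. So each
-- construction is built as syntax together with the set-theoretic statements to which its truth and
-- its falsity are equivalent. Bijections in particular are always given by a definable relation
-- first and become sets afterwards.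
--
-- A second obstacle is that a four-valued comprehension has two conditions to respect: not only
-- what makes the formula true but also whatever fails to make it false must lie in the bounding
-- set. Hence the notion `Live`, in terms of which bounds, totality and surjectivity are stated.
--
-- Finally, `⊕` and `⊙` are merely relations between two cardinals and a result. That they have
-- exactly one value at given cardinals has to be derived, and this is where it matters that
-- equality of cardinals yields an actual isomorphism, not only the other way round.

infix 1 _↔_

_↔_ : ∀ {a b} → Set a → Set b → Set (a ⊔ b)
A ↔ B = (A → B) × (B → A)

Not : ∀ {a} → Set a → Set a
Not {a} A = A → ⊥ {a}

module _ {a b} {A : Set a} {B : Set b} where

  ↔-sym : A ↔ B → B ↔ A
  ↔-sym (f , g) = g , f

  ↔-trans : ∀ {c} {C : Set c} → A ↔ B → B ↔ C → A ↔ C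
  ↔-trans (f , g) (h , k) = (λ x → h (f x)) , (λ z → g (k z))

module _ {a b c d} {A : Set a} {B : Set b} {C : Set c} {D : Set d} where

  ×-cong : A ↔ B → C ↔ D → (A × C) ↔ (B × D)
  ×-cong (f , g) (h , k) = (λ (x , y) → f x , h y) , (λ (x , y) → g x , k y)

  ⊎-cong : A ↔ B → C ↔ D → (A ⊎ C) ↔ (B ⊎ D)
  ⊎-cong (f , g) (h , k) =
    (λ { (inj₁ x) → inj₁ (f x) ; (inj₂ y) → inj₂ (h y) }) ,
    (λ { (inj₁ x) → inj₁ (g x) ; (inj₂ y) → inj₂ (k y) })

  →-cong : A ↔ B → C ↔ D → (A → C) ↔ (B → D)
  →-cong (f , g) (h , k) = (λ u b → h (u (g b))) , (λ u x → k (u (f x)))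

  ↔-cong : A ↔ B → C ↔ D → (A ↔ C) ↔ (B ↔ D)
  ↔-cong p q =
    (λ r → ↔-trans (↔-sym p) (↔-trans r q)) ,
    (λ r → ↔-trans p (↔-trans r (↔-sym q)))

Not-cong : ∀ {a} {A B : Set a} → A ↔ B → Not A ↔ Not B
Not-cong p = →-cong p (id , id)

module _ {a p q} {A : Set a} {P : A → Set p} {Q : A → Set q} where

  Π-cong : (∀ x → P x ↔ Q x) → (∀ x → P x) ↔ (∀ x → Q x)
  Π-cong e = (λ f x → proj₁ (e x) (f x)) , (λ f x → proj₂ (e x) (f x))

  Σ-cong : (∀ x → P x ↔ Q x) → Σ A P ↔ Σ A Q
  Σ-cong e = (λ (x , p) → x , proj₁ (e x) p) , (λ (x , q) → x , proj₂ (e x) q)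

module Theory
  {ℓ : Level} (em : ExcludedMiddle ℓ) (𝔐 : Model ℓ) (ax : ∀ γ → BZFC γ → 𝔐 ⊩ γ) where

  open Model 𝔐
  open Semantics 𝔐

  private variable
    m n : ℕ

  infix 8 _∈ᵖ_ _≐ᵖ_ _⊆ᵖ_
  infixr 7 ∼ᵖ_ ¬ᵖ_ !ᵖ_ ¿ᵖ_ ∘ᵖ_
  infixr 6 _∧ᵖ_ _&ᵖ_
  infixr 5 _∨ᵖ_
  infixr 4 _⟶ᵖ_ _⟷ᵖ_ _⇒ᵖ_ _⇔ᵖ_

  -- Classical reasoning in the metatheory, and renaming of variables.

  split : (P : Set ℓ) → P ⊎ Not P
  split P with em {P}
  ... | yes p = inj₁ p
  ... | no ¬p = inj₂ (λ p → Level.lift (¬p p))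

  by-contradiction : {P : Set ℓ} → Not (Not P) → P
  by-contradiction {P} ¬¬p with split P
  ... | inj₁ p  = p
  ... | inj₂ ¬p = ⊥-elim (¬¬p ¬p)

  mutual
    -- Truth and falsity have to be treated together, because `∼` exchanges them and the falsity of
    -- `⟶` mentions the truth of its premise.
    ren-true : (σ : Fin m → Fin n) (φ : Form m) {ρ : Vec Dom n} {ρ′ : Vec Dom m} →
      (∀ i → lookup ρ (σ i) ≡ lookup ρ′ i) → True (ren σ φ) ρ ↔ True φ ρ′
    ren-true σ (i ∈ᵛ j) e rewrite e i | e j = id , id
    ren-true σ (i =ᵛ j) e rewrite e i | e j = id , id
    ren-true σ ⊥ᶠ       e = id , id
    ren-true σ (∼ φ)    e = ren-false σ φ e
    ren-true σ (φ ∧ ψ)  e = ×-cong (ren-true σ φ e) (ren-true σ ψ e)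
    ren-true σ (φ ∨ ψ)  e = ⊎-cong (ren-true σ φ e) (ren-true σ ψ e)
    ren-true σ (φ ⟶ ψ)  e = →-cong (ren-true σ φ e) (ren-true σ ψ e)
    ren-true σ (φ ⟷ ψ)  e = ↔-cong (ren-true σ φ e) (ren-true σ ψ e)
    ren-true σ (∀ᶠ φ)   e = Π-cong λ x → ren-true (lift 1 σ) φ (lift-lookup e)
    ren-true σ (∃ᶠ φ)   e = Σ-cong λ x → ren-true (lift 1 σ) φ (lift-lookup e)

    ren-false : (σ : Fin m → Fin n) (φ : Form m) {ρ : Vec Dom n} {ρ′ : Vec Dom m} →
      (∀ i → lookup ρ (σ i) ≡ lookup ρ′ i) → False (ren σ φ) ρ ↔ False φ ρ′
    ren-false σ (i ∈ᵛ j) e rewrite e i | e j = id , id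
    ren-false σ (i =ᵛ j) e rewrite e i | e j = id , id
    ren-false σ ⊥ᶠ       e = id , id
    ren-false σ (∼ φ)    e = ren-true σ φ e
    ren-false σ (φ ∧ ψ)  e = ⊎-cong (ren-false σ φ e) (ren-false σ ψ e)
    ren-false σ (φ ∨ ψ)  e = ×-cong (ren-false σ φ e) (ren-false σ ψ e)
    ren-false σ (φ ⟶ ψ)  e = ×-cong (ren-true σ φ e) (ren-false σ ψ e)
    ren-false σ (φ ⟷ ψ)  e =
      ⊎-cong (×-cong (ren-true σ φ e) (ren-false σ ψ e))
             (×-cong (ren-false σ φ e) (ren-true σ ψ e))
    ren-false σ (∀ᶠ φ)   e = Σ-cong λ x → ren-false (lift 1 σ) φ (lift-lookup e)
    ren-false σ (∃ᶠ φ)   e = Π-cong λ x → ren-false (lift 1 σ) φ (lift-lookup e)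

    lift-lookup : {σ : Fin m → Fin n} {ρ : Vec Dom n} {ρ′ : Vec Dom m} {x : Dom} →
      (∀ i → lookup ρ (σ i) ≡ lookup ρ′ i) →
      ∀ i → lookup (x ∷ ρ) (lift 1 σ i) ≡ lookup (x ∷ ρ′) i
    lift-lookup e zero    = refl
    lift-lookup e (suc i) = e i

  -- A readable description of the truth and the falsity of φ.  There is one
  -- combinator per constructor and per definition of Defs, so that T and F of a
  -- concrete formula compute to the intended set-theoretic statement.
  record Pred (φ : Form n) : Set (lsuc ℓ) where
    no-eta-equality
    constructor pred
    field
      T F : Vec Dom n → Set ℓ
      T↔  : ∀ ρ → True φ ρ ↔ T ρ
      F↔  : ∀ ρ → False φ ρ ↔ F ρ

  open Pred public

  -- The function whose graph is the class term t.
  record Expr (t : Term n) : Set (lsuc ℓ) where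
    no-eta-equality
    constructor expr
    field
      val  : Vec Dom n → Dom
      val↔ : ∀ ρ x → True t (x ∷ ρ) ↔ x ≡ val ρ

  open Expr public

  -- Set-theoretic readings of connectives, quantifiers and class terms.

  private variable
    φ ψ : Form n
    s t : Term n

  ⌊_⌋ : (φ : Form n) → Pred φ
  ⌊ φ ⌋ = pred (True φ) (False φ) (λ _ → id , id) (λ _ → id , id)

  recast : (p : Pred φ) {P Q : Vec Dom n → Set ℓ} →
    (∀ ρ → T p ρ ↔ P ρ) → (∀ ρ → F p ρ ↔ Q ρ) → Pred φ
  recast p {P} {Q} e f = pred P Q
    (λ ρ → ↔-trans (T↔ p ρ) (e ρ)) (λ ρ → ↔-trans (F↔ p ρ) (f ρ))

  renᵖ : (σ : Fin m → Fin n) (π : Vec Dom n → Vec Dom m) →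
    (∀ ρ i → lookup ρ (σ i) ≡ lookup (π ρ) i) → Pred φ → Pred (ren σ φ)
  renᵖ {φ = φ} σ π e p = pred (λ ρ → T p (π ρ)) (λ ρ → F p (π ρ))
    (λ ρ → ↔-trans (ren-true σ φ (e ρ)) (T↔ p (π ρ)))
    (λ ρ → ↔-trans (ren-false σ φ (e ρ)) (F↔ p (π ρ)))

  -- Written with `head` and `tail` rather than by matching, so that the result is a visible cons
  -- even when the vector is a variable.
  skip : Vec Dom (suc (suc n)) → Vec Dom (suc n)
  skip ρ = head ρ ∷ tail (tail ρ)

  skip-lookup : (ρ : Vec Dom (suc (suc n))) (i : Fin (suc n)) →
    lookup ρ (lift 1 suc i) ≡ lookup (skip ρ) i
  skip-lookup (x ∷ y ∷ ρ) zero    = refl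
  skip-lookup (x ∷ y ∷ ρ) (suc i) = refl

  wkᵖ : Pred φ → Pred (φ ↑)
  wkᵖ = renᵖ (lift 1 suc) skip skip-lookup

  wk : Expr t → Expr (t ↑)
  wk {t = t} e = expr (λ ρ → val e (tail ρ)) λ where
    ρ@(_ ∷ ρ′) x → ↔-trans (ren-true (lift 1 suc) t (skip-lookup (x ∷ ρ))) (val↔ e ρ′ x)

  var : (i : Fin n) → Expr (v i)
  var i = expr (λ ρ → lookup ρ i) (λ _ _ → id , id)

  ⊥ᵖ : Pred {n} ⊥ᶠ
  ⊥ᵖ = ⌊ ⊥ᶠ ⌋

  ∼ᵖ_ : Pred φ → Pred (∼ φ)
  ∼ᵖ p = pred (F p) (T p) (F↔ p) (T↔ p)

  _∧ᵖ_ : Pred φ → Pred ψ → Pred (φ ∧ ψ)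
  p ∧ᵖ q = pred (λ ρ → T p ρ × T q ρ) (λ ρ → F p ρ ⊎ F q ρ)
    (λ ρ → ×-cong (T↔ p ρ) (T↔ q ρ)) (λ ρ → ⊎-cong (F↔ p ρ) (F↔ q ρ))

  _∨ᵖ_ : Pred φ → Pred ψ → Pred (φ ∨ ψ)
  p ∨ᵖ q = pred (λ ρ → T p ρ ⊎ T q ρ) (λ ρ → F p ρ × F q ρ)
    (λ ρ → ⊎-cong (T↔ p ρ) (T↔ q ρ)) (λ ρ → ×-cong (F↔ p ρ) (F↔ q ρ))

  _⟶ᵖ_ : Pred φ → Pred ψ → Pred (φ ⟶ ψ)
  p ⟶ᵖ q = pred (λ ρ → T p ρ → T q ρ) (λ ρ → T p ρ × F q ρ)
    (λ ρ → →-cong (T↔ p ρ) (T↔ q ρ)) (λ ρ → ×-cong (T↔ p ρ) (F↔ q ρ))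

  _⟷ᵖ_ : Pred φ → Pred ψ → Pred (φ ⟷ ψ)
  p ⟷ᵖ q = pred (λ ρ → T p ρ ↔ T q ρ) (λ ρ → T p ρ × F q ρ ⊎ F p ρ × T q ρ)
    (λ ρ → ↔-cong (T↔ p ρ) (T↔ q ρ))
    (λ ρ → ⊎-cong (×-cong (T↔ p ρ) (F↔ q ρ)) (×-cong (F↔ p ρ) (T↔ q ρ)))

  ∀ᵖ : Pred φ → Pred (∀ᶠ φ)
  ∀ᵖ p = pred (λ ρ → ∀ x → T p (x ∷ ρ)) (λ ρ → Σ Dom λ x → F p (x ∷ ρ))
    (λ ρ → Π-cong λ x → T↔ p (x ∷ ρ)) (λ ρ → Σ-cong λ x → F↔ p (x ∷ ρ))

  ∃ᵖ : Pred φ → Pred (∃ᶠ φ)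
  ∃ᵖ p = pred (λ ρ → Σ Dom λ x → T p (x ∷ ρ)) (λ ρ → ∀ x → F p (x ∷ ρ))
    (λ ρ → Σ-cong λ x → T↔ p (x ∷ ρ)) (λ ρ → Π-cong λ x → F↔ p (x ∷ ρ))

  -- Removing the factor `⊤` from the falsity makes `!ᵖ p` read as `T p` against `Not (T p)` by
  -- computation, and `¿ᵖ p` as `Not (F p)` against `F p`.
  ¬ᵖ_ : Pred φ → Pred (¬ φ)
  ¬ᵖ p = recast (p ⟶ᵖ ⊥ᵖ) {λ ρ → Not (T p ρ)} {T p} (λ _ → id , id) (λ _ → proj₁ , (_, tt))

  !ᵖ_ : Pred φ → Pred (! φ)
  !ᵖ p = ∼ᵖ ¬ᵖ p

  ¿ᵖ_ : Pred φ → Pred (¿ φ)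
  ¿ᵖ p = ¬ᵖ ∼ᵖ p

  ∘ᵖ_ : Pred φ → Pred (∘ φ)
  ∘ᵖ p = !ᵖ p ⟷ᵖ ¿ᵖ p

  _⇒ᵖ_ : Pred φ → Pred ψ → Pred (φ ⇒ ψ)
  p ⇒ᵖ q = (p ⟶ᵖ q) ∧ᵖ (∼ᵖ q ⟶ᵖ ∼ᵖ p)

  _⇔ᵖ_ : Pred φ → Pred ψ → Pred (φ ⇔ ψ)
  p ⇔ᵖ q = (p ⟷ᵖ q) ∧ᵖ (∼ᵖ p ⟷ᵖ ∼ᵖ q)

  _&ᵖ_ : Pred φ → Pred ψ → Pred (φ & ψ)
  p &ᵖ q = ∼ᵖ (p ⟶ᵖ ∼ᵖ q)

  -- The existential is false when φ is false at all values of `t`. As `t` has exactly one value,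
  -- both the truth and the falsity condition come down to that value.
  bindᵖ : Expr t → Pred φ → Pred (bind t φ)
  bindᵖ {φ = φ} e p = pred (λ ρ → T p (val e ρ ∷ ρ)) (λ ρ → F p (val e ρ ∷ ρ))
    (λ ρ → (λ { (x , a , b) → proj₁ (T↔ p _) (subst (λ z → True φ (z ∷ ρ)) (proj₁ (val↔ e ρ x) a) b) })
         , λ b → val e ρ , proj₂ (val↔ e ρ _) refl , proj₂ (T↔ p _) b)
    (λ ρ → (λ h → proj₁ (F↔ p _) (h (val e ρ) (proj₂ (val↔ e ρ _) refl)))
         , λ b x a → subst (λ z → False φ (z ∷ ρ)) (sym (proj₁ (val↔ e ρ x) a)) (proj₂ (F↔ p _) b))

  _∈ᵖ_ : Expr s → Expr t → Pred (s ∈ t)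
  d ∈ᵖ e = bindᵖ d (bindᵖ (wk e) ⌊ suc zero ∈ᵛ zero ⌋)

  _≐ᵖ_ : Expr s → Expr t → Pred (s ≐ t)
  d ≐ᵖ e = bindᵖ d (bindᵖ (wk e) ⌊ suc zero =ᵛ zero ⌋)

  _⊆ᵖ_ : Expr s → Expr t → Pred (s ⊆ t)
  d ⊆ᵖ e = ∀ᵖ (var zero ∈ᵖ wk d ⇒ᵖ var zero ∈ᵖ wk e)

  ∀∈ᵖ : Expr t → Pred φ → Pred (∀∈ t φ)
  ∀∈ᵖ e p = ∀ᵖ (var zero ∈ᵖ wk e ⟶ᵖ p)

  ∃∈ᵖ : Expr t → Pred φ → Pred (∃∈ t φ)
  ∃∈ᵖ e p = ∃ᵖ (var zero ∈ᵖ wk e &ᵖ p)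

  ∃!ᵖ : Pred φ → Pred (∃! φ)
  ∃!ᵖ p = ∃ᵖ (∀ᵖ (wkᵖ p ⟷ᵖ ⌊ zero =ᵛ suc zero ⌋))

  classicalᵖ : Expr t → Pred (Classical t)
  classicalᵖ e = ∀ᵖ (∘ᵖ (var zero ∈ᵖ wk e))

  nonEmptyᵖ : Expr t → Pred (NonEmpty t)
  nonEmptyᵖ e = ∃ᵖ (var zero ∈ᵖ wk e)

  v₀ᵉ : Expr {suc n} v₀
  v₀ᵉ = var zero

  v₁ᵉ : Expr {suc (suc n)} v₁
  v₁ᵉ = var (suc zero)

  v₂ᵉ : Expr {suc (suc (suc n))} v₂
  v₂ᵉ = var (suc (suc zero))

  v₃ᵉ : Expr {suc (suc (suc (suc n)))} (v (suc (suc (suc zero))))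
  v₃ᵉ = var (suc (suc (suc zero)))

  v₄ᵉ : Expr {suc (suc (suc (suc (suc n))))} (v (suc (suc (suc (suc zero)))))
  v₄ᵉ = var (suc (suc (suc (suc zero))))

  -- Instances of the axioms, extensionality and classical sets.

  satisfied : {φ : Sentence} (p : Pred φ) → BZFC φ → T p []
  satisfied p a = proj₁ (T↔ p []) (ax _ a)

  closed-instance : (φ : Form n) → 𝔐 ⊩ closure φ → ∀ ρ → True φ ρ
  closed-instance φ h []      = h
  closed-instance φ h (x ∷ ρ) = closed-instance (∀ᶠ φ) h ρ x

  -- This is what the truth of `Classical` computes to under `classicalᵖ`, so no conversion between
  -- the two is required.
  Classical⁺ : Dom → Set ℓ
  Classical⁺ A = ∀ x → x ∈⁺ A ↔ Not (x ∈⁻ A)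

  ext : ∀ {A B} → (∀ x → x ∈⁺ A ↔ x ∈⁺ B) → (∀ x → x ∈⁻ A ↔ x ∈⁻ B) → A ≡ B
  ext {A} {B} p q = proj₂ (proj₁ (ax _ extensionality A B)) λ x → p x , q x

  ∈⁻↔Not : ∀ {A} → Classical⁺ A → ∀ x → x ∈⁻ A ↔ Not (x ∈⁺ A)
  ∈⁻↔Not c x =
    (λ q p → proj₁ (c x) p q) , (λ h → by-contradiction λ ¬q → h (proj₂ (c x) ¬q))

  classical-ext : ∀ {A B} → Classical⁺ A → Classical⁺ B →
    (∀ x → x ∈⁺ A ↔ x ∈⁺ B) → A ≡ B
  classical-ext a b e = ext e λ x →
    ↔-trans (∈⁻↔Not a x) (↔-trans (Not-cong (e x)) (↔-sym (∈⁻↔Not b x)))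

  -- Classical sets and set operations

  infix 18 _!ᵉ _?ᵉ
  infix 28 _!ᴰ _?ᴰ
  infixl 12 _∪ᵉ_ _∩ᵉ_ _∖ᵉ_
  infixl 22 _∪ᴰ_ _∩ᴰ_ _∖ᴰ_

  ¬∀⇒∃¬ : {P Q : Dom → Set ℓ} → Not (∀ x → P x → Q x) → Σ Dom λ x → P x × Not (Q x)
  ¬∀⇒∃¬ h = by-contradiction λ k →
    h λ x p → by-contradiction λ ¬q → k (x , p , ¬q)

  ¬×⇒¬⊎¬ : {P Q : Set ℓ} → Not (P × Q) → Not P ⊎ Not Q
  ¬×⇒¬⊎¬ {P} h with split P
  ... | inj₁ p  = inj₂ λ q → h (p , q)
  ... | inj₂ ¬p = inj₁ ¬p

  HasExtension : (P Q : Dom → Set ℓ) → Dom → Set ℓ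
  HasExtension P Q B = ∀ x → (x ∈⁺ B ↔ P x) × (x ∈⁻ B ↔ Q x)

  Set⟨_,_⟩ : (P Q : Dom → Set ℓ) → Set ℓ
  Set⟨ P , Q ⟩ = Σ Dom (HasExtension P Q)

  Collection : (Dom → Set ℓ) → Set ℓ
  Collection P = Set⟨ P , (λ x → Not (P x)) ⟩

  extension-unique : ∀ {P Q A B} → HasExtension P Q A → HasExtension P Q B → A ≡ B
  extension-unique a b = ext (λ x → ↔-trans (proj₁ (a x)) (↔-sym (proj₁ (b x))))
                             (λ x → ↔-trans (proj₂ (a x)) (↔-sym (proj₂ (b x))))

  classical : ∀ {P Q A} → HasExtension P Q A → (∀ x → P x ↔ Not (Q x)) → Classical⁺ A
  classical h e x = ↔-trans (proj₁ (h x)) (↔-trans (e x) (Not-cong (↔-sym (proj₂ (h x)))))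

  collection-classical : ∀ {P A} → HasExtension P (λ x → Not (P x)) A → Classical⁺ A
  collection-classical h = classical h λ x → (λ p ¬p → ¬p p) , by-contradiction

  setᵉ : (p : Pred φ) (f : Vec Dom n → Dom) →
    (∀ ρ → HasExtension (λ x → T p (x ∷ ρ)) (λ x → F p (x ∷ ρ)) (f ρ)) → Expr ｛ φ ｝
  setᵉ p f h = expr f λ ρ B →
    ↔-trans (T↔ (∀ᵖ (⌊ zero ∈ᵛ suc zero ⌋ ⇔ᵖ wkᵖ p)) (B ∷ ρ))
      ((λ b → extension-unique b (h ρ)) , λ { refl → h ρ })

  -- Comprehension relative to a bound, and the basic sets.

  Bounded : (Dom → Set ℓ) → Set ℓ
  Bounded P = Σ Dom λ C → ∀ x → P x → x ∈⁺ C

  -- Membership in the realm of `A`: everything except what is plainly false.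
  Live : Dom → Dom → Set ℓ
  Live x A = x ∈⁺ A ⊎ Not (x ∈⁻ A)

  bounded-mono : ∀ {P Q} → (∀ x → P x → Q x) → Bounded Q → Bounded P
  bounded-mono f (C , h) = C , λ x p → h x (f x p)

  classical-superset : ∀ A → Σ Dom λ B → Classical⁺ B × ∀ x → (x ∈⁺ A → x ∈⁺ B) × (x ∈⁻ B → x ∈⁻ A)
  classical-superset = satisfied (∀ᵖ (∃ᵖ (classicalᵖ v₀ᵉ ∧ᵖ v₁ᵉ ⊆ᵖ v₀ᵉ))) classicalSuperset

  -- A classical superset catches the elements of status "neither" as well: `⊆` is contraposable, so
  -- what is false in `B` is false in `A`, and what is not false in the classical `B` is true in it.
  bounded-live : ∀ A → Bounded (λ x → Live x A)
  bounded-live A with classical-superset A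
  ... | B , c , h = B , λ where
    x (inj₁ p)  → proj₁ (h x) p
    x (inj₂ ¬q) → proj₂ (c x) λ q → ¬q (proj₂ (h x) q)

  opaque

    -- The axiom yields the set of all `x` with `x ∈ C ∧ φ`, where `C` is a classical superset of
    -- the bound. The first conjunct adds no truth condition, since true instances lie in `C`. It
    -- adds no falsity either: an `x` outside `C` is not live for φ, so φ is already false there.
    comprehend : {φ : Form (suc n)} (p : Pred φ) (ρ : Vec Dom n) →
      Bounded (λ x → T p (x ∷ ρ) ⊎ Not (F p (x ∷ ρ))) →
      Set⟨ (λ x → T p (x ∷ ρ)) , (λ x → F p (x ∷ ρ)) ⟩
    comprehend {φ = φ} p ρ (A , bound) with classical-superset A
    ... | C , c , A⊆C
      with closed-instance (∀ᶠ (∃ᶠ (∀ᶠ (zero ∈ᵛ suc zero ⇔ zero ∈ᵛ suc (suc zero) ∧ φ ↑ ↑))))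
             (ax _ (comprehension (φ ↑))) ρ C
    ... | B , h = B , λ x →
        let (t , f) = proj₁ (T↔ (⌊ zero ∈ᵛ suc zero ⌋ ⇔ᵖ
                        ⌊ zero ∈ᵛ suc (suc zero) ⌋ ∧ᵖ wkᵖ (wkᵖ p)) (x ∷ B ∷ C ∷ ρ)) (h x)
            inC : T p (x ∷ ρ) ⊎ Not (F p (x ∷ ρ)) → x ∈⁺ C
            inC e = proj₁ (A⊆C x) (bound x e)
        in ((λ e → proj₂ (proj₁ t e)) , (λ e → proj₂ t (inC (inj₁ e) , e)))
         , ((λ q → by-contradiction λ ¬f →
               [ proj₁ (c x) (inC (inj₂ ¬f)) , ¬f ]′ (proj₁ f q))
           , (λ q → proj₂ f (inj₂ q)))

  -- With `!` in front, "not false" and "true" coincide, so a bound on the true instances is enough.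
  collect : {φ : Form (suc n)} (p : Pred φ) (ρ : Vec Dom n) → Bounded (λ x → T p (x ∷ ρ)) →
    Collection (λ x → T p (x ∷ ρ))
  collect p ρ b = comprehend (!ᵖ p) ρ
    (bounded-mono (λ { x (inj₁ e) → e ; x (inj₂ e) → by-contradiction e }) b)

  opaque

    truths : ∀ A → Collection (λ x → x ∈⁺ A)
    truths A = collect (v₀ᵉ ∈ᵖ v₁ᵉ) (A ∷ []) (A , λ _ → id)

    possibles : ∀ A → Set⟨ (λ x → Not (x ∈⁻ A)) , (λ x → x ∈⁻ A) ⟩
    possibles A = comprehend (¿ᵖ (v₀ᵉ ∈ᵖ v₁ᵉ)) (A ∷ [])
      (bounded-mono (λ { x (inj₁ p) → inj₂ p ; x (inj₂ p) → inj₂ p }) (bounded-live A))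

    emptySet : Set⟨ (λ x → ⊥) , (λ x → ⊤) ⟩
    emptySet = comprehend ⊥ᵖ [] (point , λ { x (inj₂ h) → ⊥-elim (h tt) })

    unorderedPair : ∀ a b → Σ Dom λ B → ∀ x → x ∈⁺ B ↔ (x ≡ a ⊎ x ≡ b)
    unorderedPair a b =
      let (B , h) = satisfied (∀ᵖ (∀ᵖ (∃ᵖ (∀ᵖ (⌊ zero ∈ᵛ suc zero ⌋
                      ⇔ᵖ !ᵖ (v₀ᵉ ≐ᵖ v₃ᵉ) ∨ᵖ !ᵖ (v₀ᵉ ≐ᵖ v₂ᵉ)))))) pairing a b
      in B , λ x → proj₁ (h x)

    bigUnion : ∀ A → Σ Dom λ B → ∀ x → x ∈⁺ B ↔ Σ Dom λ z → z ∈⁺ A × x ∈⁺ z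
    bigUnion A =
      let (B , h) = satisfied (∀ᵖ (∃ᵖ (∀ᵖ (⌊ zero ∈ᵛ suc zero ⌋
                      ⇔ᵖ ∃ᵖ (v₀ᵉ ∈ᵖ v₃ᵉ ∧ᵖ v₁ᵉ ∈ᵖ v₀ᵉ))))) union A
      in B , λ x → proj₁ (h x)

    singleton : ∀ a → Collection (λ x → x ≡ a)
    singleton a = let (B , h) = unorderedPair a a in
      collect (v₀ᵉ ≐ᵖ v₁ᵉ) (a ∷ []) (B , λ x p → proj₂ (h x) (inj₁ p))

  bounded-⊎ : ∀ {P Q} → Bounded P → Bounded Q → Bounded (λ x → P x ⊎ Q x)
  bounded-⊎ (A , a) (B , b) =
    let (C , c) = unorderedPair A B
        (D , d) = bigUnion C
    in D , λ where
      x (inj₁ p) → proj₂ (d x) (A , proj₂ (c A) (inj₁ refl) , a x p)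
      x (inj₂ q) → proj₂ (d x) (B , proj₂ (c B) (inj₂ refl) , b x q)

  opaque

    binaryUnion : ∀ A B → Set⟨ (λ x → x ∈⁺ A ⊎ x ∈⁺ B) , (λ x → x ∈⁻ A × x ∈⁻ B) ⟩
    binaryUnion A B = comprehend (v₀ᵉ ∈ᵖ v₁ᵉ ∨ᵖ v₀ᵉ ∈ᵖ v₂ᵉ) (A ∷ B ∷ []) (bounded-mono
      (λ { x (inj₁ (inj₁ p)) → inj₁ (inj₁ p) ; x (inj₁ (inj₂ p)) → inj₂ (inj₁ p)
         ; x (inj₂ h) → Sum.map inj₂ inj₂ (¬×⇒¬⊎¬ h) })
      (bounded-⊎ (bounded-live A) (bounded-live B)))

    intersection : ∀ A B → Set⟨ (λ x → x ∈⁺ A × x ∈⁺ B) , (λ x → x ∈⁻ A ⊎ x ∈⁻ B) ⟩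
    intersection A B = comprehend (v₀ᵉ ∈ᵖ v₁ᵉ ∧ᵖ v₀ᵉ ∈ᵖ v₂ᵉ) (A ∷ B ∷ []) (bounded-mono
      (λ { x (inj₁ p) → inj₁ (proj₁ p) ; x (inj₂ h) → inj₂ λ q → h (inj₁ q) }) (bounded-live A))

    difference : ∀ A B → Set⟨ (λ x → x ∈⁺ A × x ∈⁻ B) , (λ x → x ∈⁻ A ⊎ x ∈⁺ B) ⟩
    difference A B = comprehend (v₀ᵉ ∈ᵖ v₁ᵉ ∧ᵖ ∼ᵖ (v₀ᵉ ∈ᵖ v₂ᵉ)) (A ∷ B ∷ []) (bounded-mono
      (λ { x (inj₁ p) → inj₁ (proj₁ p) ; x (inj₂ h) → inj₂ λ q → h (inj₁ q) }) (bounded-live A))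

  _!ᴰ _?ᴰ singᴰ : Dom → Dom
  A !ᴰ    = proj₁ (truths A)
  A ?ᴰ    = proj₁ (possibles A)
  singᴰ a = proj₁ (singleton a)

  ∅ᴰ 0ᴰ 1ᴰ : Dom
  ∅ᴰ = proj₁ emptySet
  0ᴰ = ∅ᴰ
  1ᴰ = singᴰ ∅ᴰ

  _∪ᴰ_ _∩ᴰ_ _∖ᴰ_ kpairᴰ : Dom → Dom → Dom
  A ∪ᴰ B = proj₁ (binaryUnion A B)
  A ∩ᴰ B = proj₁ (intersection A B)
  A ∖ᴰ B = proj₁ (difference A B)
  kpairᴰ a b = singᴰ (singᴰ a) ∪ᴰ singᴰ (singᴰ a ∪ᴰ singᴰ b)

  -- Here and below, "let r = … in r" makes Agda infer the class term of r bottom-up;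
  -- solving for its parts against an unfolded definition of Defs is infeasible.
  _!ᵉ : Expr t → Expr (t ^!)
  e !ᵉ =
    let r = setᵉ (!ᵖ (v₀ᵉ ∈ᵖ wk e)) (λ ρ → val e ρ !ᴰ) (λ ρ → proj₂ (truths (val e ρ))) in r

  _?ᵉ : Expr t → Expr (t ^?)
  e ?ᵉ =
    let r = setᵉ (¿ᵖ (v₀ᵉ ∈ᵖ wk e)) (λ ρ → val e ρ ?ᴰ) (λ ρ → proj₂ (possibles (val e ρ))) in r

  singᵉ : Expr t → Expr (sing t)
  singᵉ e =
    let r = setᵉ (!ᵖ (v₀ᵉ ≐ᵖ wk e)) (λ ρ → singᴰ (val e ρ)) (λ ρ → proj₂ (singleton (val e ρ))) in r

  ∅ᵉ : Expr {n} ∅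
  ∅ᵉ = let r = setᵉ ⊥ᵖ (λ _ → ∅ᴰ) (λ _ → proj₂ emptySet) in r

  0ᵉ : Expr {n} 0ˢ
  0ᵉ = ∅ᵉ

  1ᵉ : Expr {n} 1ˢ
  1ᵉ = let r = singᵉ ∅ᵉ in r

  _∪ᵉ_ : Expr s → Expr t → Expr (s ∪ t)
  d ∪ᵉ e =
    let r = setᵉ (v₀ᵉ ∈ᵖ wk d ∨ᵖ v₀ᵉ ∈ᵖ wk e)
            (λ ρ → val d ρ ∪ᴰ val e ρ) (λ ρ → proj₂ (binaryUnion (val d ρ) (val e ρ)))
    in r

  _∩ᵉ_ : Expr s → Expr t → Expr (s ∩ t)
  d ∩ᵉ e =
    let r = setᵉ (v₀ᵉ ∈ᵖ wk d ∧ᵖ v₀ᵉ ∈ᵖ wk e)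
            (λ ρ → val d ρ ∩ᴰ val e ρ) (λ ρ → proj₂ (intersection (val d ρ) (val e ρ)))
    in r

  _∖ᵉ_ : Expr s → Expr t → Expr (s ∖ t)
  d ∖ᵉ e =
    let r = setᵉ (v₀ᵉ ∈ᵖ wk d ∧ᵖ ∼ᵖ (v₀ᵉ ∈ᵖ wk e))
            (λ ρ → val d ρ ∖ᴰ val e ρ) (λ ρ → proj₂ (difference (val d ρ) (val e ρ)))
    in r

  kpairᵉ : Expr s → Expr t → Expr (kpair s t)
  kpairᵉ d e =
    let r = singᵉ (singᵉ d) ∪ᵉ singᵉ (singᵉ d ∪ᵉ singᵉ e) in r

  ∈! : ∀ A x → x ∈⁺ A !ᴰ ↔ x ∈⁺ A
  ∈! A x = proj₁ (proj₂ (truths A) x)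

  opaque
    !-classical : ∀ A → Classical⁺ (A !ᴰ)
    !-classical A = collection-classical (proj₂ (truths A))

  ∈? : ∀ A x → x ∈⁺ A ?ᴰ ↔ Not (x ∈⁻ A)
  ∈? A x = proj₁ (proj₂ (possibles A) x)

  opaque
    ?-classical : ∀ A → Classical⁺ (A ?ᴰ)
    ?-classical A = classical (proj₂ (possibles A)) λ _ → id , id

  ∈sing : ∀ a x → x ∈⁺ singᴰ a ↔ x ≡ a
  ∈sing a x = proj₁ (proj₂ (singleton a) x)

  sing-classical : ∀ a → Classical⁺ (singᴰ a)
  sing-classical a = collection-classical (proj₂ (singleton a))

  ∉∅ : ∀ {x} → Not (x ∈⁺ ∅ᴰ)
  ∉∅ {x} = proj₁ (proj₁ (proj₂ emptySet x))

  ∅-classical : Classical⁺ ∅ᴰ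
  ∅-classical = classical (proj₂ emptySet) λ _ → (λ ()) , (λ h → h tt)

  ∈∪ : ∀ A B x → x ∈⁺ A ∪ᴰ B ↔ (x ∈⁺ A ⊎ x ∈⁺ B)
  ∈∪ A B x = proj₁ (proj₂ (binaryUnion A B) x)

  ∈∩ : ∀ A B x → x ∈⁺ A ∩ᴰ B ↔ (x ∈⁺ A × x ∈⁺ B)
  ∈∩ A B x = proj₁ (proj₂ (intersection A B) x)

  ∩-classical : ∀ {A B} → Classical⁺ A → Classical⁺ B → Classical⁺ (A ∩ᴰ B)
  ∩-classical {A} {B} a b = classical (proj₂ (intersection A B)) λ x →
      (λ { (p , q) (inj₁ r) → proj₁ (a x) p r ; (p , q) (inj₂ r) → proj₁ (b x) q r })
    , (λ h → proj₂ (a x) (λ r → h (inj₁ r)) , proj₂ (b x) (λ r → h (inj₂ r)))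

  ∈∖ : ∀ A B x → x ∈⁺ A ∖ᴰ B ↔ (x ∈⁺ A × x ∈⁻ B)
  ∈∖ A B x = proj₁ (proj₂ (difference A B) x)

  ∖-classical : ∀ {A B} → Classical⁺ A → Classical⁺ B → Classical⁺ (A ∖ᴰ B)
  ∖-classical {A} {B} a b = classical (proj₂ (difference A B)) λ x →
      (λ { (p , q) (inj₁ r) → proj₁ (a x) p r ; (p , q) (inj₂ r) → proj₁ (b x) r q })
    , (λ h → proj₂ (a x) (λ r → h (inj₁ r)) , by-contradiction (λ ¬q → h (inj₂ (proj₂ (b x) ¬q))))

  0≢1 : Not (0ᴰ ≡ 1ᴰ)
  0≢1 e = ∉∅ (subst (∅ᴰ ∈⁺_) (sym e) (proj₂ (∈sing ∅ᴰ ∅ᴰ) refl))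

  kpair-member : ∀ {a b x} → x ∈⁺ kpairᴰ a b ↔ (x ≡ singᴰ a ⊎ x ≡ singᴰ a ∪ᴰ singᴰ b)
  kpair-member {a} {b} {x} = ↔-trans (∈∪ _ _ x) (⊎-cong (∈sing _ x) (∈sing _ x))

  doubleton-member : ∀ {a b x} → x ∈⁺ singᴰ a ∪ᴰ singᴰ b ↔ (x ≡ a ⊎ x ≡ b)
  doubleton-member {a} {b} {x} = ↔-trans (∈∪ _ _ x) (⊎-cong (∈sing _ x) (∈sing _ x))

  kpair-injective : ∀ {a b c d} → kpairᴰ a b ≡ kpairᴰ c d → a ≡ c × b ≡ d
  kpair-injective {a} {b} {c} {d} e with first e
    where
    first : ∀ {a b c d} → kpairᴰ a b ≡ kpairᴰ c d → a ≡ c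
    first {a} {b} {c} {d} e
      with proj₁ kpair-member (subst (singᴰ a ∈⁺_) e (proj₂ kpair-member (inj₁ refl)))
    ... | inj₁ p = proj₁ (∈sing c a) (subst (a ∈⁺_) p (proj₂ (∈sing a a) refl))
    ... | inj₂ p = sym (proj₁ (∈sing a c) (subst (c ∈⁺_) (sym p) (proj₂ doubleton-member (inj₁ refl))))
  ... | refl with second e | second (sym e)
    where
    second : ∀ {a b d} → kpairᴰ a b ≡ kpairᴰ a d → b ≡ a ⊎ b ≡ d
    second {a} {b} {d} e
      with proj₁ kpair-member (subst (singᴰ a ∪ᴰ singᴰ b ∈⁺_) e (proj₂ kpair-member (inj₂ refl)))
    ... | inj₁ p = inj₁ (proj₁ (∈sing a b) (subst (b ∈⁺_) p (proj₂ doubleton-member (inj₂ refl))))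
    ... | inj₂ p = proj₁ doubleton-member (subst (b ∈⁺_) p (proj₂ doubleton-member (inj₂ refl)))
  ... | inj₂ p | _      = refl , p
  ... | inj₁ p | inj₁ q = refl , trans p (sym q)
  ... | inj₁ p | inj₂ q = refl , sym q

  -- Ordered pairs, replacement and products

  infixl 14 _⊗ᵉ_
  infixl 12 _⊎ᵉ_
  infixl 24 _⊗ᴰ_
  infixl 22 _⊎ᴰ_

  -- Inserts a fresh variable behind the two innermost ones: the domain `A` in replacement, or the
  -- pair itself when a set of pairs is collected.
  wk₂ᵖ : {φ : Form (suc (suc n))} → Pred φ → Pred (ren (lift 2 suc) φ)
  wk₂ᵖ = renᵖ (lift 2 suc) (λ ρ → head ρ ∷ head (tail ρ) ∷ tail (tail (tail ρ)))
    (λ { (y ∷ x ∷ A ∷ ρ) → λ { zero → refl ; (suc zero) → refl ; (suc (suc i)) → refl } })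

  opaque

    replace : {φ : Form (suc (suc n))} (p : Pred φ) (ρ : Vec Dom n) {A : Dom} → Classical⁺ A →
      (∀ x → x ∈⁺ A → Σ Dom λ y → ∀ y′ → T p (y′ ∷ x ∷ ρ) ↔ y′ ≡ y) →
      Collection (λ y → Σ Dom λ x → x ∈⁺ A × T p (y ∷ x ∷ ρ))
    replace {n} {φ} p ρ {A} c f =
      let p₁ = wk₂ᵖ p
          p₂ = renᵖ replacementVars (λ ρ → head (tail ρ) ∷ head ρ ∷ tail (tail (tail ρ)))
                 (λ { (x ∷ y ∷ B ∷ ρ) → λ { zero → refl ; (suc zero) → refl ; (suc (suc i)) → refl } })
                 p₁
          axiom = classicalᵖ v₀ᵉ ∧ᵖ ∀∈ᵖ v₀ᵉ (∃!ᵖ p₁)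
                    ⟶ᵖ ∃ᵖ (∀ᵖ (⌊ zero ∈ᵛ suc zero ⌋ ⇔ᵖ ∃∈ᵖ v₂ᵉ (!ᵖ p₂)))
          (B , h) = proj₁ (T↔ axiom (A ∷ ρ))
                      (closed-instance (∀ᶠ _) (ax _ (replacement (ren (lift 2 suc) φ))) ρ A)
                      (c , f)
      in B , λ y → proj₁ (h y) ,
           ↔-trans (proj₂ (h y)) ((λ k (x , a , b) → k x a b) , (λ k x a b → k (x , a , b)))

  -- Replacement asks for a classical domain, so it is applied to the truths of the bounding set.
  bounded-image : {t : Term (suc n)} (e : Expr t) (ρ : Vec Dom n) {P : Dom → Set ℓ} → Bounded P →
    Bounded (λ y → Σ Dom λ x → y ≡ val e (x ∷ ρ) × P x)
  bounded-image e ρ (A , bound) =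
    let (B , h) = replace (v₀ᵉ ≐ᵖ wk e) ρ (!-classical A) (λ x _ → val e (x ∷ ρ) , λ _ → id , id)
    in B , λ y (x , q , p) → proj₂ (proj₁ (h y)) (x , proj₂ (∈! A x) (bound x p) , q)

  opaque

    orderedPair : ∀ a b → Set⟨
      (λ x → (Σ Dom λ y → x ≡ kpairᴰ y 0ᴰ × y ∈⁺ a) ⊎ (Σ Dom λ y → x ≡ kpairᴰ y 1ᴰ × y ∈⁺ b)) ,
      (λ x → (∀ y → x ≡ kpairᴰ y 0ᴰ → y ∈⁻ a) × (∀ y → x ≡ kpairᴰ y 1ᴰ → y ∈⁻ b)) ⟩
    orderedPair a b = comprehend
      (∃ᵖ (v₁ᵉ ≐ᵖ kpairᵉ v₀ᵉ 0ᵉ &ᵖ v₀ᵉ ∈ᵖ v₂ᵉ) ∨ᵖ ∃ᵖ (v₁ᵉ ≐ᵖ kpairᵉ v₀ᵉ 1ᵉ &ᵖ v₀ᵉ ∈ᵖ v₃ᵉ))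
      (a ∷ b ∷ [])
      (bounded-mono
        (λ { x (inj₁ (inj₁ (y , e , p))) → inj₁ (y , e , inj₁ p)
           ; x (inj₁ (inj₂ (y , e , p))) → inj₂ (y , e , inj₁ p)
           ; x (inj₂ h) → Sum.map (λ k → live (¬∀⇒∃¬ k)) (λ k → live (¬∀⇒∃¬ k)) (¬×⇒¬⊎¬ h) })
        (bounded-⊎ (bounded-image (kpairᵉ v₀ᵉ 0ᵉ) [] (bounded-live a))
                   (bounded-image (kpairᵉ v₀ᵉ 1ᵉ) [] (bounded-live b))))
      where
      live : ∀ {P : Dom → Set ℓ} {a} → (Σ Dom λ y → P y × Not (y ∈⁻ a)) → Σ Dom λ y → P y × Live y a
      live (y , p , q) = y , p , inj₂ q

  pairᴰ : Dom → Dom → Dom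
  pairᴰ a b = proj₁ (orderedPair a b)

  pairᵉ : Expr s → Expr t → Expr (pair s t)
  pairᵉ d e =
    let r = setᵉ
            (∃ᵖ (v₁ᵉ ≐ᵖ kpairᵉ v₀ᵉ 0ᵉ &ᵖ v₀ᵉ ∈ᵖ wk (wk d)) ∨ᵖ ∃ᵖ (v₁ᵉ ≐ᵖ kpairᵉ v₀ᵉ 1ᵉ &ᵖ v₀ᵉ ∈ᵖ wk (wk e)))
            (λ ρ → pairᴰ (val d ρ) (val e ρ)) (λ ρ → proj₂ (orderedPair (val d ρ) (val e ρ)))
    in r

  kpair-0≢1 : ∀ {x y} → Not (kpairᴰ x 0ᴰ ≡ kpairᴰ y 1ᴰ)
  kpair-0≢1 e = 0≢1 (proj₂ (kpair-injective e))

  ∈⁺pair₀ : ∀ a b x → kpairᴰ x 0ᴰ ∈⁺ pairᴰ a b ↔ x ∈⁺ a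
  ∈⁺pair₀ a b x = ↔-trans (proj₁ (proj₂ (orderedPair a b) _))
    ( (λ { (inj₁ (y , e , p)) → subst (_∈⁺ a) (sym (proj₁ (kpair-injective e))) p
         ; (inj₂ (y , e , p)) → ⊥-elim (kpair-0≢1 e) })
    , (λ p → inj₁ (x , refl , p)))

  ∈⁻pair₀ : ∀ a b x → kpairᴰ x 0ᴰ ∈⁻ pairᴰ a b ↔ x ∈⁻ a
  ∈⁻pair₀ a b x = ↔-trans (proj₂ (proj₂ (orderedPair a b) _))
    ( (λ (h , _) → h x refl)
    , (λ p → (λ y e → subst (_∈⁻ a) (proj₁ (kpair-injective e)) p) , (λ y e → ⊥-elim (kpair-0≢1 e))))

  ∈⁺pair₁ : ∀ a b x → kpairᴰ x 1ᴰ ∈⁺ pairᴰ a b ↔ x ∈⁺ b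
  ∈⁺pair₁ a b x = ↔-trans (proj₁ (proj₂ (orderedPair a b) _))
    ( (λ { (inj₁ (y , e , p)) → ⊥-elim (kpair-0≢1 (sym e))
         ; (inj₂ (y , e , p)) → subst (_∈⁺ b) (sym (proj₁ (kpair-injective e))) p })
    , (λ p → inj₂ (x , refl , p)))

  ∈⁻pair₁ : ∀ a b x → kpairᴰ x 1ᴰ ∈⁻ pairᴰ a b ↔ x ∈⁻ b
  ∈⁻pair₁ a b x = ↔-trans (proj₂ (proj₂ (orderedPair a b) _))
    ( (λ (_ , h) → h x refl)
    , (λ p → (λ y e → ⊥-elim (kpair-0≢1 (sym e))) , (λ y e → subst (_∈⁻ b) (proj₁ (kpair-injective e)) p)))

  pair-injective : ∀ {a b c d} → pairᴰ a b ≡ pairᴰ c d → a ≡ c × b ≡ d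
  pair-injective {a} {b} {c} {d} e =
      ext (λ x → transport (kpairᴰ x 0ᴰ ∈⁺_) (∈⁺pair₀ a b x) (∈⁺pair₀ c d x))
          (λ x → transport (kpairᴰ x 0ᴰ ∈⁻_) (∈⁻pair₀ a b x) (∈⁻pair₀ c d x))
    , ext (λ x → transport (kpairᴰ x 1ᴰ ∈⁺_) (∈⁺pair₁ a b x) (∈⁺pair₁ c d x))
          (λ x → transport (kpairᴰ x 1ᴰ ∈⁻_) (∈⁻pair₁ a b x) (∈⁻pair₁ c d x))
    where
    transport : (P : Dom → Set ℓ) {Q R : Set ℓ} → P (pairᴰ a b) ↔ Q → P (pairᴰ c d) ↔ R → Q ↔ R
    transport P f g = ↔-trans (↔-sym f) (↔-trans (subst P e , subst P (sym e)) g)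

  opaque

    slice : ∀ x B → Collection (λ z → Σ Dom λ y → z ≡ pairᴰ x y × y ∈⁺ B)
    slice x B = collect (∃ᵖ (v₁ᵉ ≐ᵖ pairᵉ v₂ᵉ v₀ᵉ ∧ᵖ v₀ᵉ ∈ᵖ v₃ᵉ)) (x ∷ B ∷ []) bound
      where
      bound : Bounded (λ z → Σ Dom λ y → z ≡ pairᴰ x y × y ∈⁺ B)
      bound = bounded-image (pairᵉ v₁ᵉ v₀ᵉ) (x ∷ []) (B , λ _ → id)

  sliceᵉ : Expr s → Expr t → Expr ｛ ! ∃ᶠ (v₁ ≐ pair (s ↑ ↑) v₀ ∧ v₀ ∈ t ↑ ↑) ｝
  sliceᵉ d e =
    let r = setᵉ (!ᵖ ∃ᵖ (v₁ᵉ ≐ᵖ pairᵉ (wk (wk d)) v₀ᵉ ∧ᵖ v₀ᵉ ∈ᵖ wk (wk e)))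
            (λ ρ → proj₁ (slice (val d ρ) (val e ρ))) (λ ρ → proj₂ (slice (val d ρ) (val e ρ)))
    in r

  -- Replacement moves one variable at a time: the pairs with a fixed first entry form a slice, the
  -- slices form an image, and the union of that image contains all the pairs.
  bounded-pairs : ∀ {P Q} → Bounded P → Bounded Q →
    Bounded (λ z → Σ Dom λ x → Σ Dom λ y → z ≡ pairᴰ x y × P x × Q y)
  bounded-pairs p (B , b) =
    let (C , c) = bounded-image (sliceᵉ v₀ᵉ v₁ᵉ) (B ∷ []) p
        (D , d) = bigUnion C
    in D , λ z (x , y , e , px , qy) → proj₂ (d z)
         (proj₁ (slice x B) , c _ (x , refl , px) , proj₂ (proj₁ (proj₂ (slice x B) z)) (y , e , b y qy))

  opaque

    product : ∀ A B → Set⟨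
      (λ z → Σ Dom λ x → Σ Dom λ y → z ≡ pairᴰ x y × x ∈⁺ A × y ∈⁺ B) ,
      (λ z → ∀ x y → z ≡ pairᴰ x y → x ∈⁻ A ⊎ y ∈⁻ B) ⟩
    product A B = comprehend 
      (∃ᵖ (∃ᵖ (v₂ᵉ ≐ᵖ pairᵉ v₁ᵉ v₀ᵉ &ᵖ (v₁ᵉ ∈ᵖ v₃ᵉ ∧ᵖ v₀ᵉ ∈ᵖ v₄ᵉ)))) (A ∷ B ∷ [])
      (bounded-mono
        (λ { z (inj₁ (x , y , e , p , q)) → x , y , e , inj₁ p , inj₁ q
           ; z (inj₂ h) → by-contradiction λ k → h λ x y e →
               by-contradiction λ l → k (x , y , e , inj₂ (λ p → l (inj₁ p)) , inj₂ (λ q → l (inj₂ q))) })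
        (bounded-pairs (bounded-live A) (bounded-live B)))

    tagged : ∀ A e → Set⟨ (λ z → Σ Dom λ x → z ≡ pairᴰ x e × x ∈⁺ A) ,
                          (λ z → ∀ x → z ≡ pairᴰ x e → x ∈⁻ A) ⟩
    tagged A e = comprehend (∃ᵖ (v₁ᵉ ≐ᵖ pairᵉ v₀ᵉ v₃ᵉ &ᵖ v₀ᵉ ∈ᵖ v₂ᵉ)) (A ∷ e ∷ [])
      (bounded-mono
        (λ { z (inj₁ (x , q , p)) → x , q , inj₁ p
           ; z (inj₂ h) → let (x , q , p) = ¬∀⇒∃¬ h in x , q , inj₂ p })
        (bounded-image (pairᵉ v₀ᵉ v₁ᵉ) (e ∷ []) (bounded-live A)))

  _⊗ᴰ_ _⊎ᴰ_ : Dom → Dom → Dom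
  A ⊗ᴰ B = proj₁ (product A B)
  A ⊎ᴰ B = proj₁ (tagged A 0ᴰ) ∪ᴰ proj₁ (tagged B 1ᴰ)

  _⊗ᵉ_ : Expr s → Expr t → Expr (s ⊗ t)
  d ⊗ᵉ e =
    let r = setᵉ (∃ᵖ (∃ᵖ (v₂ᵉ ≐ᵖ pairᵉ v₁ᵉ v₀ᵉ &ᵖ (v₁ᵉ ∈ᵖ wk (wk (wk d)) ∧ᵖ v₀ᵉ ∈ᵖ wk (wk (wk e))))))
            (λ ρ → val d ρ ⊗ᴰ val e ρ) (λ ρ → proj₂ (product (val d ρ) (val e ρ)))
    in r

  _⊎ᵉ_ : Expr s → Expr t → Expr (s ⊎ˢ t)
  d ⊎ᵉ e =
    let r = setᵉ (∃ᵖ (v₁ᵉ ≐ᵖ pairᵉ v₀ᵉ 0ᵉ &ᵖ v₀ᵉ ∈ᵖ wk (wk d)))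
                     (λ ρ → proj₁ (tagged (val d ρ) 0ᴰ)) (λ ρ → proj₂ (tagged (val d ρ) 0ᴰ))
                ∪ᵉ setᵉ (∃ᵖ (v₁ᵉ ≐ᵖ pairᵉ v₀ᵉ 1ᵉ &ᵖ v₀ᵉ ∈ᵖ wk (wk e)))
                     (λ ρ → proj₁ (tagged (val e ρ) 1ᴰ)) (λ ρ → proj₂ (tagged (val e ρ) 1ᴰ))
    in r

  -- Status-preserving bijections

  infix 8 _≈ᵖ_

  SameStatus : (x A y B : Dom) → Set ℓ
  SameStatus x A y B = (x ∈⁺ A ↔ y ∈⁺ B) × (x ∈⁻ A ↔ y ∈⁻ B)

  live-resp : ∀ {x A y B} → SameStatus x A y B → Live x A ↔ Live y B
  live-resp (p , q) = ⊎-cong p (Not-cong q)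

  live⇒∈ : ∀ {x A} → Classical⁺ A → Live x A → x ∈⁺ A
  live⇒∈ c (inj₁ p)  = p
  live⇒∈ c (inj₂ ¬q) = proj₂ (c _) ¬q

  members-sameStatus : ∀ {x A y B} → Classical⁺ A → Classical⁺ B → x ∈⁺ A → y ∈⁺ B → SameStatus x A y B
  members-sameStatus a b p q =
    ((λ _ → q) , λ _ → p) , ((λ r → ⊥-elim (proj₁ (a _) p r)) , (λ r → ⊥-elim (proj₁ (b _) q r)))

  -- R is a bijection between the realms of A and B which preserves the status
  -- (true, both, neither) of membership.
  record IsIso (R : Dom → Dom → Set ℓ) (A B : Dom) : Set ℓ where
    field
      live       : ∀ {x y} → R x y → Live x A
      status     : ∀ {x y} → R x y → SameStatus x A y B
      total      : ∀ {x} → Live x A → Σ Dom λ y → R x y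
      onto       : ∀ {y} → Live y B → Σ Dom λ x → R x y
      functional : ∀ {x y y′} → R x y → R x y′ → y ≡ y′
      injective  : ∀ {x x′ y} → R x y → R x′ y → x ≡ x′

  -- In contrast to `IsIso`, which speaks of any relation of the metatheory, the relation is here a
  -- set of the model and can witness its quantifiers. The field `graph-pairs` excludes stray
  -- elements, as the inclusion in `X ⊗ᴰ Y` within `Bijection` demands.
  record Iso (A B : Dom) : Set ℓ where
    field
      graph           : Dom
      graph-classical : Classical⁺ graph
      graph-pairs     : ∀ z → z ∈⁺ graph → Σ Dom λ x → Σ Dom λ y → z ≡ pairᴰ x y
      isIso           : IsIso (λ x y → pairᴰ x y ∈⁺ graph) A B
    open IsIso isIso public

  isIso-resp : ∀ {R S A B} → (∀ x y → S x y ↔ R x y) → IsIso R A B → IsIso S A B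
  isIso-resp e i = record
    { live       = λ r → live (proj₁ (e _ _) r)
    ; status     = λ r → status (proj₁ (e _ _) r)
    ; total      = λ l → let (y , r) = total l in y , proj₂ (e _ _) r
    ; onto       = λ l → let (x , r) = onto l in x , proj₂ (e _ _) r
    ; functional = λ r s → functional (proj₁ (e _ _) r) (proj₁ (e _ _) s)
    ; injective  = λ r s → injective (proj₁ (e _ _) r) (proj₁ (e _ _) s)
    } where open IsIso i

  -- A definable isomorphism is a set, since its pairs have live entries and the live elements of
  -- `A` and `B` are bounded.
  iso : {φ : Form (suc (suc n))} (p : Pred φ) (ρ : Vec Dom n) {A B : Dom} →
    IsIso (λ x y → T p (y ∷ x ∷ ρ)) A B → Iso A B
  iso p ρ {A} {B} i = record
    { graph           = proj₁ pairs
    ; graph-classical = collection-classical (proj₂ pairs)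
    ; graph-pairs     = λ z q → let (x , y , e , _) = proj₁ (member z) q in x , y , e
    ; isIso           = isIso-resp (λ x y → ↔-trans (member (pairᴰ x y))
        ( (λ (x′ , y′ , e , r) → let (ex , ey) = pair-injective e in
             subst (λ y → T p (y ∷ x ∷ ρ)) (sym ey) (subst (λ x → T p (y′ ∷ x ∷ ρ)) (sym ex) r))
        , (λ r → x , y , refl , r))) i
    }
    where
    open IsIso i
    bound : Bounded (λ z → Σ Dom λ x → Σ Dom λ y → z ≡ pairᴰ x y × T p (y ∷ x ∷ ρ))
    bound = bounded-mono (λ z (x , y , e , r) → x , y , e , live r , proj₁ (live-resp (status r)) (live r))
      (bounded-pairs (bounded-live A) (bounded-live B))
    pairs : Collection (λ z → Σ Dom λ x → Σ Dom λ y → z ≡ pairᴰ x y × T p (y ∷ x ∷ ρ))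
    pairs = collect (∃ᵖ (∃ᵖ (v₂ᵉ ≐ᵖ pairᵉ v₁ᵉ v₀ᵉ ∧ᵖ wk₂ᵖ p))) ρ bound
    member = λ z → proj₁ (proj₂ pairs z)

  iso-sym : ∀ {A B} → Iso A B → Iso B A
  iso-sym i = iso (pairᵉ v₀ᵉ v₁ᵉ ∈ᵖ v₂ᵉ) (graph ∷ []) record
    { live       = λ r → proj₁ (live-resp (status r)) (live r)
    ; status     = λ r → let (p , q) = status r in ↔-sym p , ↔-sym q
    ; total      = onto
    ; onto       = total
    ; functional = injective
    ; injective  = functional
    } where open Iso i

  iso-trans : ∀ {A B C} → Iso A B → Iso B C → Iso A C
  iso-trans i j = iso (∃ᵖ (pairᵉ v₂ᵉ v₀ᵉ ∈ᵖ v₃ᵉ ∧ᵖ pairᵉ v₀ᵉ v₁ᵉ ∈ᵖ v₄ᵉ)) (I.graph ∷ J.graph ∷ []) record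
    { live       = λ (_ , r , _) → I.live r
    ; status     = λ (_ , r , s) →
        let (p , q) = I.status r ; (p′ , q′) = J.status s in ↔-trans p p′ , ↔-trans q q′
    ; total      = λ l → let (y , r) = I.total l
                             (z , s) = J.total (proj₁ (live-resp (I.status r)) l)
                         in z , y , r , s
    ; onto       = λ l → let (y , s) = J.onto l
                             (x , r) = I.onto (proj₂ (live-resp (J.status s)) l)
                         in x , y , r , s
    ; functional = λ { (_ , r , s) (_ , r′ , s′) → helper (I.functional r r′) s s′ }
    ; injective  = λ { (_ , r , s) (_ , r′ , s′) → helper′ (J.injective s s′) r r′ }
    }
    where
    module I = Iso i
    module J = Iso j
    helper : ∀ {y y′ z z′} → y ≡ y′ → pairᴰ y z ∈⁺ J.graph → pairᴰ y′ z′ ∈⁺ J.graph → z ≡ z′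
    helper refl = J.functional
    helper′ : ∀ {y y′ x x′} → y ≡ y′ → pairᴰ x y ∈⁺ I.graph → pairᴰ x′ y′ ∈⁺ I.graph → x ≡ x′
    helper′ refl = I.injective

  -- Meant for `X` and `Y` cut out by the same condition on the status of membership. As the
  -- isomorphism preserves status, restricting it on the left restricts it on the right too.
  iso-restrict : ∀ {A B X Y} → Iso A B → Classical⁺ X → Classical⁺ Y →
    (∀ x → x ∈⁺ X → Live x A) → (∀ y → y ∈⁺ Y → Live y B) →
    (∀ {x y} → SameStatus x A y B → x ∈⁺ X ↔ y ∈⁺ Y) → Iso X Y
  iso-restrict {X = X} i cX cY X⊆A Y⊆B e = iso (pairᵉ v₁ᵉ v₀ᵉ ∈ᵖ v₂ᵉ ∧ᵖ v₁ᵉ ∈ᵖ v₃ᵉ) (graph ∷ X ∷ []) record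
    { live       = λ (_ , p) → inj₁ p
    ; status     = λ (r , p) → members-sameStatus cX cY p (proj₁ (e (status r)) p)
    ; total      = λ l → let p = live⇒∈ cX l ; (y , r) = total (X⊆A _ p) in y , r , p
    ; onto       = λ l → let q = live⇒∈ cY l ; (x , r) = onto (Y⊆B _ q)
                         in x , r , proj₂ (e (status r)) q
    ; functional = λ (r , _) (s , _) → functional r s
    ; injective  = λ (r , _) (s , _) → injective r s
    } where open Iso i

  bijectionᵖ : {r s t : Term n} → Expr r → Expr s → Expr t → Pred (Bijection r s t)
  bijectionᵖ f d e = let p = classicalᵖ f
                           ∧ᵖ f ⊆ᵖ d ⊗ᵉ e
                           ∧ᵖ ∀∈ᵖ d (∃!ᵖ (pairᵉ v₁ᵉ v₀ᵉ ∈ᵖ wk (wk f)))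
                           ∧ᵖ ∀∈ᵖ e (∃!ᵖ (pairᵉ v₀ᵉ v₁ᵉ ∈ᵖ wk (wk f)))
                     in p

  _≈ᵖ_ : {s t : Term n} → Expr s → Expr t → Pred (s ≈ t)
  d ≈ᵖ e = let p = ∃ᵖ (bijectionᵖ v₀ᵉ (wk d) (wk e)) in p

  Equinumerous : Dom → Dom → Set ℓ
  Equinumerous X Y = T (v₀ᵉ ≈ᵖ v₁ᵉ) (X ∷ Y ∷ [])

  ∈⊗ : ∀ {A B x y} → pairᴰ x y ∈⁺ A ⊗ᴰ B ↔ (x ∈⁺ A × y ∈⁺ B)
  ∈⊗ {A} {B} = ↔-trans (proj₁ (proj₂ (product A B) _))
    ( (λ (_ , _ , e , p , q) → let (ex , ey) = pair-injective e in
        subst (_∈⁺ A) (sym ex) p , subst (_∈⁺ B) (sym ey) q)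
    , (λ (p , q) → _ , _ , refl , p , q))

  ∈⁻⊗ : ∀ {A B x y} → pairᴰ x y ∈⁻ A ⊗ᴰ B ↔ (x ∈⁻ A ⊎ y ∈⁻ B)
  ∈⁻⊗ {A} {B} = ↔-trans (proj₂ (proj₂ (product A B) _))
    ( (λ h → h _ _ refl)
    , (λ p _ _ e → let (ex , ey) = pair-injective e in
        Sum.map (subst (_∈⁻ A) ex) (subst (_∈⁻ B) ey) p))

  module _ {X Y : Dom} (cX : Classical⁺ X) (cY : Classical⁺ Y) where

    equinumerous⇒iso : Equinumerous X Y → Iso X Y
    equinumerous⇒iso (f , _ , f⊆ , total , onto) = iso (pairᵉ v₁ᵉ v₀ᵉ ∈ᵖ v₂ᵉ) (f ∷ []) record
      { live       = λ r → inj₁ (proj₁ (members r))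
      ; status     = λ r → let (p , q) = members r in members-sameStatus cX cY p q
      ; total      = λ l → let (y , h) = total _ (live⇒∈ cX l) in y , proj₂ (h y) refl
      ; onto       = λ l → let (x , h) = onto _ (live⇒∈ cY l) in x , proj₂ (h x) refl
      ; functional = λ r s → let (_ , h) = total _ (proj₁ (members r))
                             in trans (proj₁ (h _) r) (sym (proj₁ (h _) s))
      ; injective  = λ r s → let (_ , h) = onto _ (proj₂ (members r))
                             in trans (proj₁ (h _) r) (sym (proj₁ (h _) s))
      }
      where
      members : ∀ {x y} → pairᴰ x y ∈⁺ f → x ∈⁺ X × y ∈⁺ Y
      members r = proj₁ ∈⊗ (proj₁ (f⊆ _) r)

    iso⇒equinumerous : Iso X Y → Equinumerous X Y
    iso⇒equinumerous i =
        graph , graph-classical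
      -- Inclusion has a falsity half: what is false in `X ⊗ᴰ Y` must be false in the graph. It
      -- follows from the truth half because both sets are classical.
      , (λ z → member z , λ q → by-contradiction λ ¬q →
           proj₁ (product-classical z) (member z (proj₂ (graph-classical z) ¬q)) q)
      , (λ x p → let (y , r) = total (inj₁ p)
                 in y , λ y′ → (λ r′ → functional r′ r) , λ { refl → r })
      , (λ y q → let (x , r) = onto (inj₁ q)
                 in x , λ x′ → (λ r′ → injective r′ r) , λ { refl → r })
      where
      open Iso i
      product-classical : Classical⁺ (X ⊗ᴰ Y)
      product-classical = classical (proj₂ (product X Y)) λ z →
          (λ { (x , y , e , p , q) h → [ proj₁ (cX x) p , proj₁ (cY y) q ]′ (h x y e) })
        , (λ h → by-contradiction λ k → h λ x y e → by-contradiction λ l →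
             k (x , y , e , proj₂ (cX x) (λ p → l (inj₁ p)) , proj₂ (cY y) (λ q → l (inj₂ q))))
      member : ∀ z → z ∈⁺ graph → z ∈⁺ X ⊗ᴰ Y
      member z p with graph-pairs z p
      ... | x , y , refl = proj₂ ∈⊗
        ( live⇒∈ cX (live p)
        , live⇒∈ cY (proj₁ (live-resp (status p)) (live p)) )

  -- Disjoint sums, products and the three parts of a set

  ∈⁺⊎₀ : ∀ {A B x} → pairᴰ x 0ᴰ ∈⁺ A ⊎ᴰ B ↔ x ∈⁺ A
  ∈⁺⊎₀ {A} {B} {x} = ↔-trans (∈∪ _ _ _) (↔-trans
    (⊎-cong (proj₁ (proj₂ (tagged A 0ᴰ) _)) (proj₁ (proj₂ (tagged B 1ᴰ) _)))
    ( (λ { (inj₁ (_ , e , p)) → subst (_∈⁺ A) (sym (proj₁ (pair-injective e))) p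
         ; (inj₂ (_ , e , p)) → ⊥-elim (0≢1 (proj₂ (pair-injective e))) })
    , (λ p → inj₁ (_ , refl , p))))

  ∈⁺⊎₁ : ∀ {A B x} → pairᴰ x 1ᴰ ∈⁺ A ⊎ᴰ B ↔ x ∈⁺ B
  ∈⁺⊎₁ {A} {B} {x} = ↔-trans (∈∪ _ _ _) (↔-trans
    (⊎-cong (proj₁ (proj₂ (tagged A 0ᴰ) _)) (proj₁ (proj₂ (tagged B 1ᴰ) _)))
    ( (λ { (inj₁ (_ , e , p)) → ⊥-elim (0≢1 (sym (proj₂ (pair-injective e))))
         ; (inj₂ (_ , e , p)) → subst (_∈⁺ B) (sym (proj₁ (pair-injective e))) p })
    , (λ p → inj₂ (_ , refl , p))))

  ∈⁻⊎ : ∀ {A B z} → z ∈⁻ A ⊎ᴰ B ↔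
    ((∀ x → z ≡ pairᴰ x 0ᴰ → x ∈⁻ A) × (∀ x → z ≡ pairᴰ x 1ᴰ → x ∈⁻ B))
  ∈⁻⊎ {A} {B} {z} = ↔-trans (proj₂ (proj₂ (binaryUnion _ _) z))
    (×-cong (proj₂ (proj₂ (tagged A 0ᴰ) z)) (proj₂ (proj₂ (tagged B 1ᴰ) z)))

  ∈⁻⊎₀ : ∀ {A B x} → pairᴰ x 0ᴰ ∈⁻ A ⊎ᴰ B ↔ x ∈⁻ A
  ∈⁻⊎₀ {A} {B} {x} = ↔-trans ∈⁻⊎
    ( (λ (h , _) → h x refl)
    , (λ p → (λ _ e → subst (_∈⁻ A) (proj₁ (pair-injective e)) p)
           , (λ _ e → ⊥-elim (0≢1 (proj₂ (pair-injective e))))))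

  ∈⁻⊎₁ : ∀ {A B x} → pairᴰ x 1ᴰ ∈⁻ A ⊎ᴰ B ↔ x ∈⁻ B
  ∈⁻⊎₁ {A} {B} {x} = ↔-trans ∈⁻⊎
    ( (λ (_ , h) → h x refl)
    , (λ p → (λ _ e → ⊥-elim (0≢1 (sym (proj₂ (pair-injective e)))))
           , (λ _ e → subst (_∈⁻ B) (proj₁ (pair-injective e)) p)))

  live-⊎ : ∀ {A B z} → Live z (A ⊎ᴰ B) →
    (Σ Dom λ x → z ≡ pairᴰ x 0ᴰ × Live x A) ⊎ (Σ Dom λ x → z ≡ pairᴰ x 1ᴰ × Live x B)
  live-⊎ {A} {B} (inj₁ p) with proj₁ (∈∪ _ _ _) p
  ... | inj₁ q = let (x , e , r) = proj₁ (proj₁ (proj₂ (tagged A 0ᴰ) _)) q in inj₁ (x , e , inj₁ r)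
  ... | inj₂ q = let (x , e , r) = proj₁ (proj₁ (proj₂ (tagged B 1ᴰ) _)) q in inj₂ (x , e , inj₁ r)
  live-⊎ {A} {B} (inj₂ ¬q) with ¬×⇒¬⊎¬ (λ h → ¬q (proj₂ ∈⁻⊎ h))
  ... | inj₁ h = let (x , e , r) = ¬∀⇒∃¬ h in inj₁ (x , e , inj₂ r)
  ... | inj₂ h = let (x , e , r) = ¬∀⇒∃¬ h in inj₂ (x , e , inj₂ r)

  live-⊗ : ∀ {A B z} → Live z (A ⊗ᴰ B) →
    Σ Dom λ x → Σ Dom λ y → z ≡ pairᴰ x y × Live x A × Live y B
  live-⊗ {A} {B} {z} (inj₁ p) with proj₁ (proj₁ (proj₂ (product A B) z)) p
  ... | x , y , e , q , r = x , y , e , inj₁ q , inj₁ r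
  live-⊗ {A} {B} {z} (inj₂ ¬p) = by-contradiction λ k → ¬p (proj₂ (proj₂ (proj₂ (product A B) z))
    λ x y e → by-contradiction λ l → k (x , y , e , inj₂ (λ p → l (inj₁ p)) , inj₂ (λ q → l (inj₂ q))))

  iso-⊎ : ∀ {A A′ B B′} → Iso A A′ → Iso B B′ → Iso (A ⊎ᴰ B) (A′ ⊎ᴰ B′)
  iso-⊎ {A} {A′} {B} {B′} i j = iso
    (∃ᵖ (∃ᵖ ( (v₃ᵉ ≐ᵖ pairᵉ v₁ᵉ 0ᵉ ∧ᵖ v₂ᵉ ≐ᵖ pairᵉ v₀ᵉ 0ᵉ ∧ᵖ pairᵉ v₁ᵉ v₀ᵉ ∈ᵖ v₄ᵉ)
           ∨ᵖ (v₃ᵉ ≐ᵖ pairᵉ v₁ᵉ 1ᵉ ∧ᵖ v₂ᵉ ≐ᵖ pairᵉ v₀ᵉ 1ᵉ ∧ᵖ pairᵉ v₁ᵉ v₀ᵉ ∈ᵖ var 5F))))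
    (I.graph ∷ J.graph ∷ []) record
    { live       = λ { (_ , _ , inj₁ (refl , refl , r)) → proj₂ (live-resp (∈⁺⊎₀ , ∈⁻⊎₀)) (I.live r)
                     ; (_ , _ , inj₂ (refl , refl , r)) → proj₂ (live-resp (∈⁺⊎₁ , ∈⁻⊎₁)) (J.live r) }
    ; status     = λ { (_ , _ , inj₁ (refl , refl , r)) → let (p , q) = I.status r in
                         ↔-trans ∈⁺⊎₀ (↔-trans p (↔-sym ∈⁺⊎₀)) , ↔-trans ∈⁻⊎₀ (↔-trans q (↔-sym ∈⁻⊎₀))
                     ; (_ , _ , inj₂ (refl , refl , r)) → let (p , q) = J.status r in
                         ↔-trans ∈⁺⊎₁ (↔-trans p (↔-sym ∈⁺⊎₁)) , ↔-trans ∈⁻⊎₁ (↔-trans q (↔-sym ∈⁻⊎₁)) }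
    ; total      = total
    ; onto       = onto
    ; functional = λ { (_ , _ , inj₁ (refl , refl , r)) (_ , _ , inj₁ (e , refl , s)) →
                         helper (I.functional r (subst (λ x → pairᴰ x _ ∈⁺ _) (sym (proj₁ (pair-injective e))) s))
                     ; (_ , _ , inj₁ (refl , refl , r)) (_ , _ , inj₂ (e , refl , s)) →
                         ⊥-elim (0≢1 (proj₂ (pair-injective e)))
                     ; (_ , _ , inj₂ (refl , refl , r)) (_ , _ , inj₁ (e , refl , s)) →
                         ⊥-elim (0≢1 (sym (proj₂ (pair-injective e))))
                     ; (_ , _ , inj₂ (refl , refl , r)) (_ , _ , inj₂ (e , refl , s)) →
                         helper (J.functional r (subst (λ x → pairᴰ x _ ∈⁺ _) (sym (proj₁ (pair-injective e))) s)) }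
    ; injective  = λ { (_ , _ , inj₁ (refl , refl , r)) (_ , _ , inj₁ (refl , e , s)) →
                         helper (I.injective r (subst (λ x → pairᴰ _ x ∈⁺ _) (sym (proj₁ (pair-injective e))) s))
                     ; (_ , _ , inj₁ (refl , refl , r)) (_ , _ , inj₂ (refl , e , s)) →
                         ⊥-elim (0≢1 (proj₂ (pair-injective e)))
                     ; (_ , _ , inj₂ (refl , refl , r)) (_ , _ , inj₁ (refl , e , s)) →
                         ⊥-elim (0≢1 (sym (proj₂ (pair-injective e))))
                     ; (_ , _ , inj₂ (refl , refl , r)) (_ , _ , inj₂ (refl , e , s)) →
                         helper (J.injective r (subst (λ x → pairᴰ _ x ∈⁺ _) (sym (proj₁ (pair-injective e))) s)) }
    }
    where
    module I = Iso i
    module J = Iso j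

    helper : ∀ {x y e} → x ≡ y → pairᴰ x e ≡ pairᴰ y e
    helper refl = refl

    Rel : Dom → Dom → Set ℓ
    Rel z w = Σ Dom λ x → Σ Dom λ y →
      (z ≡ pairᴰ x 0ᴰ × w ≡ pairᴰ y 0ᴰ × pairᴰ x y ∈⁺ I.graph) ⊎
      (z ≡ pairᴰ x 1ᴰ × w ≡ pairᴰ y 1ᴰ × pairᴰ x y ∈⁺ J.graph)

    total : ∀ {z} → Live z (A ⊎ᴰ B) → Σ Dom λ w → Rel z w
    total l with live-⊎ l
    ... | inj₁ (x , e , k) = let (y , r) = I.total k in _ , x , y , inj₁ (e , refl , r)
    ... | inj₂ (x , e , k) = let (y , r) = J.total k in _ , x , y , inj₂ (e , refl , r)

    onto : ∀ {w} → Live w (A′ ⊎ᴰ B′) → Σ Dom λ z → Rel z w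
    onto l with live-⊎ l
    ... | inj₁ (y , e , k) = let (x , r) = I.onto k in _ , x , y , inj₁ (refl , e , r)
    ... | inj₂ (y , e , k) = let (x , r) = J.onto k in _ , x , y , inj₂ (refl , e , r)

  -- A pair of live elements need not be live, as "true" and "neither" conjoin
  -- to "false"; hence the extra clause in the relation.
  iso-⊗ : ∀ {A A′ B B′} → Iso A A′ → Iso B B′ → Iso (A ⊗ᴰ B) (A′ ⊗ᴰ B′)
  iso-⊗ {A} {A′} {B} {B′} i j = iso
    (∃ᵖ (∃ᵖ (∃ᵖ (∃ᵖ (var 5F ≐ᵖ pairᵉ v₃ᵉ v₂ᵉ ∧ᵖ v₄ᵉ ≐ᵖ pairᵉ v₁ᵉ v₀ᵉ
                     ∧ᵖ pairᵉ v₃ᵉ v₁ᵉ ∈ᵖ var 6F ∧ᵖ pairᵉ v₂ᵉ v₀ᵉ ∈ᵖ var 7F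
                     ∧ᵖ (var 5F ∈ᵖ var 8F ∨ᵖ ¿ᵖ (var 5F ∈ᵖ var 8F)))))))
    (I.graph ∷ J.graph ∷ A ⊗ᴰ B ∷ []) record
    { live       = λ (_ , _ , _ , _ , _ , _ , _ , _ , l) → l
    ; status     = status
    ; total      = λ l → let (x , y , e , k , k′) = live-⊗ l
                             (x′ , r) = I.total k
                             (y′ , s) = J.total k′
                         in _ , x , y , x′ , y′ , e , refl , r , s , l
    ; onto       = λ l → let (x′ , y′ , e , k , k′) = live-⊗ l
                             (x , r) = I.onto k
                             (y , s) = J.onto k′
                         in _ , x , y , x′ , y′ , refl , e , r , s
                          , proj₂ (live-resp (pair-status r s)) (subst (λ w → Live w _) e l)
    ; functional = functional
    ; injective  = injective
    }
    where
    module I = Iso i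
    module J = Iso j

    pair-status : ∀ {x x′ y y′} → pairᴰ x x′ ∈⁺ I.graph → pairᴰ y y′ ∈⁺ J.graph →
      SameStatus (pairᴰ x y) (A ⊗ᴰ B) (pairᴰ x′ y′) (A′ ⊗ᴰ B′)
    pair-status r s = let (p , q) = I.status r ; (p′ , q′) = J.status s in
      ↔-trans ∈⊗ (↔-trans (×-cong p p′) (↔-sym ∈⊗)) ,
      ↔-trans ∈⁻⊗ (↔-trans (⊎-cong q q′) (↔-sym ∈⁻⊗))

    Rel : Dom → Dom → Set ℓ
    Rel z w = Σ Dom λ x → Σ Dom λ y → Σ Dom λ x′ → Σ Dom λ y′ →
      z ≡ pairᴰ x y × w ≡ pairᴰ x′ y′ × pairᴰ x x′ ∈⁺ I.graph × pairᴰ y y′ ∈⁺ J.graph × Live z (A ⊗ᴰ B)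

    status : ∀ {z w} → Rel z w → SameStatus z (A ⊗ᴰ B) w (A′ ⊗ᴰ B′)
    status (_ , _ , _ , _ , refl , refl , r , s , _) = pair-status r s

    functional : ∀ {z w w′} → Rel z w → Rel z w′ → w ≡ w′
    functional (_ , _ , _ , _ , refl , refl , r , s , _) (_ , _ , _ , _ , e , refl , r′ , s′ , _)
      with pair-injective e
    ... | refl , refl = cong₂ pairᴰ (I.functional r r′) (J.functional s s′)

    injective : ∀ {z z′ w} → Rel z w → Rel z′ w → z ≡ z′
    injective (_ , _ , _ , _ , refl , refl , r , s , _) (_ , _ , _ , _ , refl , e , r′ , s′ , _)
      with pair-injective e
    ... | refl , refl = cong₂ pairᴰ (I.injective r r′) (J.injective s s′)

  -- The three statuses of membership and the parts of a set.

  data Status : Set where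
    true both neither : Status

  part : Status → Dom → Dom
  part true    A = A !ᴰ ∩ᴰ A ?ᴰ
  part both    A = A !ᴰ ∖ᴰ A ?ᴰ
  part neither A = A ?ᴰ ∖ᴰ A !ᴰ

  HasStatus : Status → Dom → Dom → Set ℓ
  HasStatus true    x A = x ∈⁺ A × Not (x ∈⁻ A)
  HasStatus both    x A = x ∈⁺ A × x ∈⁻ A
  HasStatus neither x A = Not (x ∈⁻ A) × Not (x ∈⁺ A)

  part-member : ∀ s {A x} → x ∈⁺ part s A ↔ HasStatus s x A
  part-member true {A} {x} = ↔-trans (∈∩ _ _ x) (×-cong (∈! A x) (∈? A x))
  part-member both {A} {x} = ↔-trans (∈∖ _ _ x) (×-cong (∈! A x) (proj₂ (proj₂ (possibles A) x)))
  part-member neither {A} {x} = ↔-trans (∈∖ _ _ x) (×-cong (∈? A x) (proj₂ (proj₂ (truths A) x)))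

  opaque
    part-classical : ∀ s {A} → Classical⁺ (part s A)
    part-classical true    {A} = ∩-classical (!-classical A) (?-classical A)
    part-classical both    {A} = ∖-classical (!-classical A) (?-classical A)
    part-classical neither {A} = ∖-classical (?-classical A) (!-classical A)

  status-unique : ∀ s s′ {x A} → HasStatus s x A → HasStatus s′ x A → s ≡ s′
  status-unique true    true    _         _         = refl
  status-unique true    both    (_ , ¬q)  (_ , q)   = ⊥-elim (¬q q)
  status-unique true    neither (p , _)   (_ , ¬p)  = ⊥-elim (¬p p)
  status-unique both    true    (_ , q)   (_ , ¬q)  = ⊥-elim (¬q q)
  status-unique both    both    _         _         = refl
  status-unique both    neither (p , _)   (_ , ¬p)  = ⊥-elim (¬p p)
  status-unique neither true    (_ , ¬p)  (p , _)   = ⊥-elim (¬p p)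
  status-unique neither both    (_ , ¬p)  (p , _)   = ⊥-elim (¬p p)
  status-unique neither neither _         _         = refl

  status-live : ∀ s {x A} → HasStatus s x A → Live x A
  status-live true    (p , _) = inj₁ p
  status-live both    (p , _) = inj₁ p
  status-live neither (q , _) = inj₂ q

  live-status : ∀ {x A} → Live x A → Σ Status λ s → HasStatus s x A
  live-status {x} {A} l with split (x ∈⁺ A) | split (x ∈⁻ A) | l
  ... | inj₁ p  | inj₁ q  | _       = both , p , q
  ... | inj₁ p  | inj₂ ¬q | _       = true , p , ¬q
  ... | inj₂ ¬p | _       | inj₁ p  = ⊥-elim (¬p p)
  ... | inj₂ ¬p | _       | inj₂ ¬q = neither , ¬q , ¬p

  hasStatus-resp : ∀ s {x A y B} → SameStatus x A y B → HasStatus s x A ↔ HasStatus s y B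
  hasStatus-resp true    (p , q) = ×-cong p (Not-cong q)
  hasStatus-resp both    (p , q) = ×-cong p q
  hasStatus-resp neither (p , q) = ×-cong (Not-cong q) (Not-cong p)

  hasStatus-same : ∀ s {x A y B} → HasStatus s x A → HasStatus s y B → SameStatus x A y B
  hasStatus-same true    (p , ¬q)  (p′ , ¬q′)  =
    ((λ _ → p′) , λ _ → p) , ((λ q → ⊥-elim (¬q q)) , λ q → ⊥-elim (¬q′ q))
  hasStatus-same both    (p , q)   (p′ , q′)   = ((λ _ → p′) , λ _ → p) , ((λ _ → q′) , λ _ → q)
  hasStatus-same neither (¬q , ¬p) (¬q′ , ¬p′) =
    ((λ p → ⊥-elim (¬p p)) , λ p → ⊥-elim (¬p′ p)) , ((λ q → ⊥-elim (¬q q)) , λ q → ⊥-elim (¬q′ q))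

  -- Formulas cannot quantify over `Status`; a relation is therefore written as a threefold
  -- disjunction and then handled as a sum over the statuses.
  ∃-status : {P : Status → Set ℓ} → (P true ⊎ P both ⊎ P neither) ↔ Σ Status P
  ∃-status =
    (λ { (inj₁ p) → true , p ; (inj₂ (inj₁ p)) → both , p ; (inj₂ (inj₂ p)) → neither , p }) ,
    (λ { (true , p) → inj₁ p ; (both , p) → inj₂ (inj₁ p) ; (neither , p) → inj₂ (inj₂ p) })

  iso-parts : ∀ {A B} → Iso A B → ∀ s → Iso (part s A) (part s B)
  iso-parts i s = iso-restrict i (part-classical s) (part-classical s)
    (λ x p → status-live s (proj₁ (part-member s) p))
    (λ y p → status-live s (proj₁ (part-member s) p))
    (λ e → ↔-trans (part-member s) (↔-trans (hasStatus-resp s e) (↔-sym (part-member s))))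

  -- The three graphs glue together because the statuses exclude one another and exhaust the realm,
  -- on the left as well as on the right.
  iso-from-parts : ∀ {A B} → (∀ s → Iso (part s A) (part s B)) → Iso A B
  iso-from-parts {A} {B} i = iso
    (pairᵉ v₁ᵉ v₀ᵉ ∈ᵖ v₂ᵉ ∨ᵖ pairᵉ v₁ᵉ v₀ᵉ ∈ᵖ v₃ᵉ ∨ᵖ pairᵉ v₁ᵉ v₀ᵉ ∈ᵖ v₄ᵉ)
    (I.graph true ∷ I.graph both ∷ I.graph neither ∷ [])
    (isIso-resp (λ x y → ∃-status) record
      { live       = λ (s , r) → status-live s (left s r)
      ; status     = λ (s , r) → hasStatus-same s (left s r) (right s r)
      ; total      = λ l → let (s , h) = live-status l
                               (y , r) = I.total s (inj₁ (proj₂ (part-member s) h))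
                           in y , s , r
      ; onto       = λ l → let (s , h) = live-status l
                               (x , r) = I.onto s (inj₁ (proj₂ (part-member s) h))
                           in x , s , r
      ; functional = λ { (s , r) (s′ , r′) → functional (status-unique s s′ (left s r) (left s′ r′)) r r′ }
      ; injective  = λ { (s , r) (s′ , r′) → injective (status-unique s s′ (right s r) (right s′ r′)) r r′ }
      })
    where
    module I s = Iso (i s)

    left : ∀ s {x y} → pairᴰ x y ∈⁺ I.graph s → HasStatus s x A
    left s r = proj₁ (part-member s) (live⇒∈ (part-classical s) (I.live s r))

    right : ∀ s {x y} → pairᴰ x y ∈⁺ I.graph s → HasStatus s y B
    right s r = proj₁ (part-member s)
      (live⇒∈ (part-classical s) (proj₁ (live-resp (I.status s r)) (I.live s r)))

    functional : ∀ {s s′ x y y′} → s ≡ s′ → pairᴰ x y ∈⁺ I.graph s → pairᴰ x y′ ∈⁺ I.graph s′ → y ≡ y′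
    functional {s} refl = I.functional s

    injective : ∀ {s s′ x x′ y} → s ≡ s′ → pairᴰ x y ∈⁺ I.graph s → pairᴰ x′ y ∈⁺ I.graph s′ → x ≡ x′
    injective {s} refl = I.injective s

  -- Ordinals

  rlmᵉ : Expr t → Expr (rlm t)
  rlmᵉ e = let r = e !ᵉ ∪ᵉ e ?ᵉ in r

  ∈-minimal : ∀ {A x} → x ∈⁺ A → Σ Dom λ m → m ∈⁺ A × ∀ y → y ∈⁺ A → Not (y ∈⁺ m)
  ∈-minimal {A} {x} p =
    let (m , q , h) = satisfied
          (∀ᵖ (nonEmptyᵖ v₀ᵉ ⟶ᵖ ∃∈ᵖ v₀ᵉ (∀∈ᵖ v₁ᵉ (¬ᵖ (v₀ᵉ ∈ᵖ rlmᵉ v₁ᵉ))))) foundation A (x , p)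
    in m , q , λ y r s → h y r (proj₂ (∈∪ _ _ _) (inj₁ (proj₂ (∈! m y) s)))

  -- Transfinite induction in the form of a minimal counterexample, for properties given by a
  -- formula.
  minimal-satisfying : {φ : Form (suc n)} (p : Pred φ) (ρ : Vec Dom n) {A x : Dom} →
    x ∈⁺ A → T p (x ∷ ρ) →
    Σ Dom λ m → m ∈⁺ A × T p (m ∷ ρ) × (∀ y → y ∈⁺ A → T p (y ∷ ρ) → Not (y ∈⁺ m))
  minimal-satisfying p ρ {A} x∈A px =
    let (m , q , h) = ∈-minimal (proj₂ (member _) (x∈A , px))
        (m∈A , pm) = proj₁ (member m) q
    in m , m∈A , pm , λ y r s → h y (proj₂ (member y) (r , s))
    where
    bound : Bounded (λ x → x ∈⁺ A × T p (x ∷ ρ))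
    bound = A , λ _ → proj₁
    S : Collection (λ x → x ∈⁺ A × T p (x ∷ ρ))
    S = collect (v₀ᵉ ∈ᵖ v₁ᵉ ∧ᵖ wkᵖ p) (A ∷ ρ) bound
    member = λ x → proj₁ (proj₂ S x)

  ordinalᵖ : Expr t → Pred (Ordinal t)
  ordinalᵖ e = let p = classicalᵖ e
                     ∧ᵖ ∀∈ᵖ e (classicalᵖ v₀ᵉ)
                     ∧ᵖ ∀∈ᵖ e (v₀ᵉ ⊆ᵖ wk e)
                     ∧ᵖ ∀∈ᵖ e (¬ᵖ (v₀ᵉ ∈ᵖ v₀ᵉ))
                     ∧ᵖ ∀∈ᵖ e (∀∈ᵖ (wk e) (∀∈ᵖ (wk (wk e)) (v₂ᵉ ∈ᵖ v₁ᵉ ∧ᵖ v₁ᵉ ∈ᵖ v₀ᵉ ⟶ᵖ v₂ᵉ ∈ᵖ v₀ᵉ)))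
                     ∧ᵖ ∀∈ᵖ e (∀∈ᵖ (wk e) (v₁ᵉ ∈ᵖ v₀ᵉ ∨ᵖ v₁ᵉ ≐ᵖ v₀ᵉ ∨ᵖ v₀ᵉ ∈ᵖ v₁ᵉ))
                     ∧ᵖ ∀ᵖ (classicalᵖ v₀ᵉ ∧ᵖ v₀ᵉ ⊆ᵖ wk e ∧ᵖ nonEmptyᵖ v₀ᵉ
                             ⟶ᵖ ∃∈ᵖ v₀ᵉ (∀∈ᵖ v₁ᵉ (v₁ᵉ ∈ᵖ v₀ᵉ ∨ᵖ v₁ᵉ ≐ᵖ v₀ᵉ)))
               in p

  _⊆⁺_ : Dom → Dom → Set ℓ
  A ⊆⁺ B = ∀ x → x ∈⁺ A → x ∈⁺ B

  classical-⊆ : ∀ {A B} → Classical⁺ A → Classical⁺ B → A ⊆⁺ B →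
    ∀ x → (x ∈⁺ A → x ∈⁺ B) × (x ∈⁻ B → x ∈⁻ A)
  classical-⊆ a b h x = h x , λ q → proj₂ (∈⁻↔Not a x) λ p → proj₁ (b x) (h x p) q

  ⊆-antisym : ∀ {A B} → Classical⁺ A → Classical⁺ B → A ⊆⁺ B → B ⊆⁺ A → A ≡ B
  ⊆-antisym a b h k = classical-ext a b λ x → h x , k x

  drop-third : {P Q R : Set ℓ} → P ⊎ Q ⊎ R → Not R → P ⊎ Q
  drop-third (inj₁ p)        ¬r = inj₁ p
  drop-third (inj₂ (inj₁ q)) ¬r = inj₂ q
  drop-third (inj₂ (inj₂ r)) ¬r = ⊥-elim (¬r r)

  record Ord (α : Dom) : Set ℓ where
    constructor ord
    field
      is-classical      : Classical⁺ α
      elements-classical : ∀ β → β ∈⁺ α → Classical⁺ β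
      ∈-elements         : ∀ {β γ} → γ ∈⁺ β → β ∈⁺ α → γ ∈⁺ α
      ∈-trans            : ∀ {x y z} → z ∈⁺ α → x ∈⁺ y → y ∈⁺ z → x ∈⁺ z
      ∈-irrefl           : ∀ {β} → β ∈⁺ α → Not (β ∈⁺ β)
      ∈-trichotomy       : ∀ {x y} → x ∈⁺ α → y ∈⁺ α → x ∈⁺ y ⊎ x ≡ y ⊎ y ∈⁺ x

  open Ord public

  ordinal⇒ord : ∀ {α} → T (ordinalᵖ v₀ᵉ) (α ∷ []) → Ord α
  ordinal⇒ord (c , ec , tr , irr , trs , tri , _) = record
    { is-classical       = c
    ; elements-classical = ec
    ; ∈-elements         = λ p q → proj₁ (tr _ q _) p
    ; ∈-trans            = λ r p q → let y∈α = proj₁ (tr _ r _) q in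
                             trs _ (proj₁ (tr _ y∈α _) p) _ y∈α _ r (p , q)
    ; ∈-irrefl           = λ p → irr _ p
    ; ∈-trichotomy       = λ p q → tri _ p _ q
    }

  ord⇒ordinal : ∀ {α} → Ord α → T (ordinalᵖ v₀ᵉ) (α ∷ [])
  ord⇒ordinal o = c , elements-classical o
    , (λ β p → classical-⊆ (elements-classical o β p) c λ γ q → ∈-elements o q p)
    , (λ β p → ∈-irrefl o p)
    , (λ x p y q z r (s , t) → ∈-trans o r s t)
    , (λ x p y q → ∈-trichotomy o p q)
    -- Foundation provides the least element: an ∈-minimal `m` is compared with each `y` by
    -- trichotomy, and minimality excludes `y ∈ m`.
    , λ S (cS , S⊆α , x , p) →
        let (m , q , h) = ∈-minimal p in
        m , q , λ y r → drop-third (∈-trichotomy o (proj₁ (S⊆α m) q) (proj₁ (S⊆α y) r)) (h y r)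
    where c = is-classical o

  ord-element : ∀ {α β} → Ord α → β ∈⁺ α → Ord β
  ord-element {β = β} o p = record
    { is-classical       = elements-classical o _ p
    ; elements-classical = λ γ q → elements-classical o γ (up q)
    ; ∈-elements         = λ r q → ∈-trans o p r q
    ; ∈-trans            = λ r → ∈-trans o (up r)
    ; ∈-irrefl           = λ q → ∈-irrefl o (up q)
    ; ∈-trichotomy       = λ q r → ∈-trichotomy o (up q) (up r)
    }
    where
    up : ∀ {γ} → γ ∈⁺ β → γ ∈⁺ _
    up q = ∈-elements o q p

  ord-irrefl : ∀ {α} → Ord α → Not (α ∈⁺ α)
  ord-irrefl o p = ∈-irrefl o p p

  -- If `α` has elements outside `γ`, a minimal one `m` equals `γ`: minimality gives `m ⊆ γ`, and an
  -- element of `γ` not in `m` would, by trichotomy and transitivity, put `m` into `γ`.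
  transitive-proper-subset : ∀ {α γ} → Ord α → Classical⁺ γ → (∀ {x y} → x ∈⁺ y → y ∈⁺ γ → x ∈⁺ γ) →
    γ ⊆⁺ α → γ ≡ α ⊎ γ ∈⁺ α
  transitive-proper-subset {α} {γ} o cγ tr γ⊆α with split (α ⊆⁺ γ)
  ... | inj₁ α⊆γ = inj₁ (⊆-antisym cγ (is-classical o) γ⊆α α⊆γ)
  ... | inj₂ α⊈γ =
    let (x , x∈α , x∉γ) = ¬∀⇒∃¬ α⊈γ
    in inj₂ (member (minimal-satisfying (¬ᵖ (v₀ᵉ ∈ᵖ v₁ᵉ)) (γ ∷ []) x∈α x∉γ))
    where
    member : (Σ Dom λ m → m ∈⁺ α × Not (m ∈⁺ γ) × (∀ y → y ∈⁺ α → Not (y ∈⁺ γ) → Not (y ∈⁺ m))) → γ ∈⁺ α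
    member (m , m∈α , m∉γ , h) =
      subst (_∈⁺ α) (⊆-antisym (elements-classical o m m∈α) cγ m⊆γ γ⊆m) m∈α
      where
      m⊆γ : m ⊆⁺ γ
      m⊆γ y y∈m = by-contradiction λ y∉γ → h y (∈-elements o y∈m m∈α) y∉γ y∈m
      γ⊆m : γ ⊆⁺ m
      γ⊆m y y∈γ with ∈-trichotomy o (γ⊆α y y∈γ) m∈α
      ... | inj₁ y∈m         = y∈m
      ... | inj₂ (inj₁ refl) = ⊥-elim (m∉γ y∈γ)
      ... | inj₂ (inj₂ m∈y)  = ⊥-elim (m∉γ (tr m∈y y∈γ))

  -- The intersection is a transitive subset of both, hence equal to or an element of each. It
  -- cannot be an element of both, for then it would be an element of itself.
  ord-compare : ∀ {α β} → Ord α → Ord β → α ∈⁺ β ⊎ α ≡ β ⊎ β ∈⁺ α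
  ord-compare {α} {β} a b
    with transitive-proper-subset a cγ tr (λ x p → proj₁ (proj₁ (∈∩ α β x) p))
       | transitive-proper-subset b cγ tr (λ x p → proj₂ (proj₁ (∈∩ α β x) p))
    where
    cγ : Classical⁺ (α ∩ᴰ β)
    cγ = ∩-classical (is-classical a) (is-classical b)
    tr : ∀ {x y} → x ∈⁺ y → y ∈⁺ α ∩ᴰ β → x ∈⁺ α ∩ᴰ β
    tr p q = let (r , s) = proj₁ (∈∩ α β _) q in
      proj₂ (∈∩ α β _) (∈-elements a p r , ∈-elements b p s)
  ... | inj₁ p | inj₁ q = inj₂ (inj₁ (trans (sym p) q))
  ... | inj₁ p | inj₂ q = inj₁ (subst (_∈⁺ β) p q)
  ... | inj₂ p | inj₁ q = inj₂ (inj₂ (subst (_∈⁺ α) q p))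
  ... | inj₂ p | inj₂ q = ⊥-elim (∈-irrefl a p (proj₂ (∈∩ α β _) (p , q)))

  ord-from-elements : ∀ {A} → Classical⁺ A → (∀ {β γ} → γ ∈⁺ β → β ∈⁺ A → γ ∈⁺ A) →
    (∀ β → β ∈⁺ A → Ord β) → Ord A
  ord-from-elements c tr o = record
    { is-classical       = c
    ; elements-classical = λ β p → is-classical (o β p)
    ; ∈-elements         = tr
    ; ∈-trans            = λ r p q → ∈-elements (o _ r) p q
    ; ∈-irrefl           = λ p → ord-irrefl (o _ p)
    ; ∈-trichotomy       = λ p q → ord-compare (o _ p) (o _ q)
    }

  least-ordinal : {φ : Form (suc n)} (p : Pred φ) (ρ : Vec Dom n) {α : Dom} → Ord α → T p (α ∷ ρ) →
    Σ Dom λ μ → Ord μ × T p (μ ∷ ρ) × (∀ β → Ord β → T p (β ∷ ρ) → μ ∈⁺ β ⊎ μ ≡ β)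
  least-ordinal p ρ {α} o pα with split (Σ Dom λ β → β ∈⁺ α × T p (β ∷ ρ))
  ... | inj₂ none = α , o , pα , λ β oβ pβ →
        drop-third (ord-compare o oβ) (λ β∈α → none (β , β∈α , pβ))
  ... | inj₁ (β , β∈α , pβ) =
    let (m , m∈α , pm , h) = minimal-satisfying p ρ β∈α pβ
    in m , ord-element o m∈α , pm , λ γ oγ pγ →
         drop-third (ord-compare (ord-element o m∈α) oγ) (λ γ∈m → h γ (∈-elements o γ∈m m∈α) pγ γ∈m)

  -- The well-ordering theorem

  record ChoiceFunction (X c : Dom) : Set ℓ where
    field
      chooses    : ∀ {S x} → Classical⁺ S → S ⊆⁺ X → x ∈⁺ S → Σ Dom λ y → pairᴰ S y ∈⁺ c
      member     : ∀ {S y} → pairᴰ S y ∈⁺ c → y ∈⁺ S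
      functional : ∀ {S y y′} → pairᴰ S y ∈⁺ c → pairᴰ S y′ ∈⁺ c → y ≡ y′

  functionOnᵖ : {s t : Term n} → Expr s → Expr t → Pred (FunctionOn s t)
  functionOnᵖ f e = let p = classicalᵖ f
                          ∧ᵖ ∀∈ᵖ f (∃∈ᵖ (wk e) (∃ᵖ (v₂ᵉ ≐ᵖ pairᵉ v₁ᵉ v₀ᵉ)))
                          ∧ᵖ ∀∈ᵖ e (∃!ᵖ (pairᵉ v₁ᵉ v₀ᵉ ∈ᵖ wk (wk f)))
                    in p

  choice-axiom : ∀ X → (Classical⁺ X × ∀ S → S ∈⁺ X → Σ Dom λ x → x ∈⁺ S) →
    Σ Dom λ c →
      ( Classical⁺ c
      × (∀ z → z ∈⁺ c → Σ Dom λ S → S ∈⁺ X × Σ Dom λ y → z ≡ pairᴰ S y)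
      × (∀ S → S ∈⁺ X → Σ Dom λ y → ∀ y′ → pairᴰ S y′ ∈⁺ c ↔ y′ ≡ y))
      × (∀ S → S ∈⁺ X → Σ Dom λ y → y ∈⁺ S × pairᴰ S y ∈⁺ c)
  choice-axiom = satisfied
    (∀ᵖ (classicalᵖ v₀ᵉ ∧ᵖ ∀∈ᵖ v₀ᵉ (nonEmptyᵖ v₀ᵉ)
      ⟶ᵖ ∃ᵖ (functionOnᵖ v₀ᵉ v₁ᵉ ∧ᵖ ∀∈ᵖ v₁ᵉ (∃∈ᵖ v₀ᵉ (pairᵉ v₁ᵉ v₀ᵉ ∈ᵖ v₂ᵉ))))) choice

  power-axiom : ∀ X → Σ Dom λ P → ∀ S →
    (S ∈⁺ P ↔ (∀ x → (x ∈⁺ S → x ∈⁺ X) × (x ∈⁻ X → x ∈⁻ S))) ×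
    (S ∈⁻ P ↔ Not (∀ x → (x ∈⁺ S → x ∈⁺ X) × (x ∈⁻ X → x ∈⁻ S)))
  power-axiom = satisfied (∀ᵖ (∃ᵖ (∀ᵖ (⌊ zero ∈ᵛ suc zero ⌋ ⇔ᵖ !ᵖ (v₀ᵉ ⊆ᵖ v₂ᵉ))))) powerSet

  choiceFunction : ∀ {X} → Classical⁺ X → Σ Dom λ c → ChoiceFunction X c
  choiceFunction {X} cX = c , record
    { chooses    = λ cS S⊆X p →
        let r = proj₂ (proj₁ (proj₂ (power-axiom X) _)) (classical-⊆ cS cX S⊆X)
            (y , _ , q) = chosen-∈ _ (proj₂ (family-member _) (r , _ , p))
        in y , q
    ; member     = λ p → let (y , q , r) = chosen-∈ _ (domain p)
                             (_ , h) = fun _ (domain p)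
                         in subst (_∈⁺ _) (trans (proj₁ (h _) r) (sym (proj₁ (h _) p))) q
    ; functional = λ p q → let (_ , h) = fun _ (domain p)
                           in trans (proj₁ (h _) p) (sym (proj₁ (h _) q))
    }
    where
    -- All non-empty subsets enter, classical or not. The sets given to `chooses` are classical,
    -- which upgrades `S ⊆⁺ X` to the two-sided inclusion in the power set axiom.
    family : Collection (λ S → S ∈⁺ proj₁ (power-axiom X) × Σ Dom λ x → x ∈⁺ S)
    family = collect (v₀ᵉ ∈ᵖ v₁ᵉ ∧ᵖ nonEmptyᵖ v₀ᵉ) (proj₁ (power-axiom X) ∷ [])
      (proj₁ (power-axiom X) , λ _ → proj₁)
    family-member = λ S → proj₁ (proj₂ family S)

    chosen = choice-axiom (proj₁ family)
      (collection-classical (proj₂ family) , λ S p → proj₂ (proj₁ (family-member S) p))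
    c = proj₁ chosen
    fun = proj₂ (proj₂ (proj₁ (proj₂ chosen)))
    chosen-∈ = proj₂ (proj₂ chosen)

    domain : ∀ {S y} → pairᴰ S y ∈⁺ c → S ∈⁺ proj₁ family
    domain p = let (S , q , _ , e) = proj₁ (proj₂ (proj₁ (proj₂ chosen))) _ p in
      subst (_∈⁺ proj₁ family) (sym (proj₁ (pair-injective e))) q

  -- y is the element which c chooses from the complement in X of the values of f below b.
  Nextᶠ : (f b y X c : Term n) → Form n
  Nextᶠ f b y X c = ∃ᶠ
    (  Classical v₀
    ∧ ∀ᶠ (v₀ ∈ v₁ ⟷ v₀ ∈ X ↑ ↑ ∧ ¬ ∃ᶠ (v₀ ∈ b ↑ ↑ ↑ ∧ pair v₀ v₁ ∈ f ↑ ↑ ↑))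
    ∧ pair v₀ (y ↑) ∈ c ↑)

  -- A partial solution of the recursion. Nothing is asked of `f` outside `b`, so an attempt at an
  -- ordinal is, unchanged, an attempt at each smaller one.
  Attemptᶠ : (f b X c : Term n) → Form n
  Attemptᶠ f b X c = ∀∈ b
    (  ∃ᶠ (pair v₁ v₀ ∈ f ↑ ↑)
    ∧ ∀ᶠ (pair v₁ v₀ ∈ f ↑ ↑ ⟶ Nextᶠ (f ↑ ↑) v₁ v₀ (X ↑ ↑) (c ↑ ↑)))

  -- The recursion takes the value `x` at `b`. Asking for some attempt is harmless because attempts
  -- agree; having it as a formula makes it usable in collection, replacement and `iso`.
  Hitᶠ : (b x X c : Term n) → Form n
  Hitᶠ b x X c = Ordinal b ∧ ∃ᶠ (Attemptᶠ v₀ (b ↑) (X ↑) (c ↑) ∧ Nextᶠ v₀ (b ↑) (x ↑) (X ↑) (c ↑))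

  nextᵖ : {f b y X c : Term n} → Expr f → Expr b → Expr y → Expr X → Expr c → Pred (Nextᶠ f b y X c)
  nextᵖ f b y X c = let p = ∃ᵖ
                          (  classicalᵖ v₀ᵉ
                          ∧ᵖ ∀ᵖ (v₀ᵉ ∈ᵖ v₁ᵉ ⟷ᵖ v₀ᵉ ∈ᵖ wk (wk X)
                                  ∧ᵖ ¬ᵖ ∃ᵖ (v₀ᵉ ∈ᵖ wk (wk (wk b)) ∧ᵖ pairᵉ v₀ᵉ v₁ᵉ ∈ᵖ wk (wk (wk f))))
                          ∧ᵖ pairᵉ v₀ᵉ (wk y) ∈ᵖ wk c)
                    in p

  attemptᵖ : {f b X c : Term n} → Expr f → Expr b → Expr X → Expr c → Pred (Attemptᶠ f b X c)
  attemptᵖ f b X c = let p = ∀∈ᵖ b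
                           (  ∃ᵖ (pairᵉ v₁ᵉ v₀ᵉ ∈ᵖ wk (wk f))
                           ∧ᵖ ∀ᵖ (pairᵉ v₁ᵉ v₀ᵉ ∈ᵖ wk (wk f)
                                   ⟶ᵖ nextᵖ (wk (wk f)) v₁ᵉ v₀ᵉ (wk (wk X)) (wk (wk c))))
                     in p

  hitᵖ : {b x X c : Term n} → Expr b → Expr x → Expr X → Expr c → Pred (Hitᶠ b x X c)
  hitᵖ b x X c = let p = ordinalᵖ b ∧ᵖ ∃ᵖ
                           (  attemptᵖ v₀ᵉ (wk b) (wk X) (wk c)
                           ∧ᵖ nextᵖ v₀ᵉ (wk b) (wk x) (wk X) (wk c))
                 in p

  module WellOrdering {X c : Dom} (cX : Classical⁺ X) (choose : ChoiceFunction X c) where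
    open ChoiceFunction choose

    Next : Dom → Dom → Dom → Set ℓ
    Next f β y = Σ Dom λ S → Classical⁺ S
      × (∀ x → x ∈⁺ S ↔ (x ∈⁺ X × Not (Σ Dom λ γ → γ ∈⁺ β × pairᴰ γ x ∈⁺ f)))
      × pairᴰ S y ∈⁺ c

    Attempt : Dom → Dom → Set ℓ
    Attempt f α = ∀ β → β ∈⁺ α →
      (Σ Dom λ y → pairᴰ β y ∈⁺ f) × (∀ y → pairᴰ β y ∈⁺ f → Next f β y)

    Hit : Dom → Dom → Set ℓ
    Hit x β = T (ordinalᵖ v₀ᵉ) (β ∷ []) × Σ Dom λ f → Attempt f β × Next f β x

    -- The variables are ordinal, element, `X`, `c`, in this order, so that the relation leads from
    -- elements to ordinals.
    hit : Pred {4} _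
    hit = hitᵖ v₀ᵉ v₁ᵉ v₂ᵉ v₃ᵉ

    AgreeAt : Dom → Dom → Dom → Set ℓ
    AgreeAt f g β = ∀ y → pairᴰ β y ∈⁺ f ↔ pairᴰ β y ∈⁺ g

    next-unique : ∀ {f β y y′} → Next f β y → Next f β y′ → y ≡ y′
    next-unique {y = y} (S , cS , S↔ , p) (S′ , cS′ , S′↔ , p′) =
      functional (subst (λ S → pairᴰ S y ∈⁺ c)
        (classical-ext cS cS′ λ x → ↔-trans (S↔ x) (↔-sym (S′↔ x))) p) p′

    next-cong : ∀ {f g β} → (∀ γ → γ ∈⁺ β → AgreeAt f g γ) → ∀ {y} → Next f β y → Next g β y
    next-cong e (S , cS , S↔ , p) = S , cS , (λ x → ↔-trans (S↔ x) (×-cong (id , id) (Not-cong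
      ( (λ (γ , q , r) → γ , q , proj₁ (e γ q x) r)
      , (λ (γ , q , r) → γ , q , proj₂ (e γ q x) r))))) , p

    next-∈ : ∀ {f β y} → Next f β y → y ∈⁺ X
    next-∈ (S , cS , S↔ , p) = proj₁ (proj₁ (S↔ _) (member p))

    next-fresh : ∀ {f β γ y} → Next f β y → γ ∈⁺ β → Not (pairᴰ γ y ∈⁺ f)
    next-fresh (S , cS , S↔ , p) q r = proj₂ (proj₁ (S↔ _) (member p)) (_ , q , r)

    attempt-below : ∀ {f α β} → Ord α → β ∈⁺ α → Attempt f α → Attempt f β
    attempt-below o p a γ q = a γ (∈-elements o q p)

    attempt-value : ∀ {f α β y} → Attempt f α → β ∈⁺ α → Next f β y → pairᴰ β y ∈⁺ f
    attempt-value {f} {β = β} a p n = let ((y , q) , h) = a β p in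
      subst (λ y → pairᴰ β y ∈⁺ f) (next-unique {f} {β} (h y q) n) q

    attempts-agree : ∀ {f g α} → Ord α → Attempt f α → Attempt g α → ∀ β → β ∈⁺ α → AgreeAt f g β
    attempts-agree {f} {g} {α} o a b β p = by-contradiction λ ¬e → absurd
      (minimal-satisfying (¬ᵖ ∀ᵖ (pairᵉ v₁ᵉ v₀ᵉ ∈ᵖ v₂ᵉ ⟷ᵖ pairᵉ v₁ᵉ v₀ᵉ ∈ᵖ v₃ᵉ)) (f ∷ g ∷ []) p ¬e)
      where
      absurd : Not (Σ Dom λ m → m ∈⁺ α × Not (AgreeAt f g m) × (∀ y → y ∈⁺ α → Not (AgreeAt f g y) → Not (y ∈⁺ m)))
      absurd (m , q , ¬e , h) = ¬e λ y →
          (λ r → attempt-value b q (next-cong below (proj₂ (a m q) y r)))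
        , (λ r → attempt-value a q (next-cong (λ γ s y → ↔-sym (below γ s y)) (proj₂ (b m q) y r)))
        where
        below : ∀ γ → γ ∈⁺ m → AgreeAt f g γ
        below γ s = by-contradiction λ ¬e → h γ (∈-elements o s q) ¬e s

    hit-∈ : ∀ {x β} → Hit x β → x ∈⁺ X
    hit-∈ (_ , f , _ , n) = next-∈ n

    hit-ord : ∀ {x β} → Hit x β → Ord β
    hit-ord (o , _) = ordinal⇒ord o

    hit-value : ∀ {x y β} → Hit x β → Hit y β → x ≡ y
    hit-value h@(_ , f , a , n) (_ , g , b , n′) =
      next-unique n (next-cong (attempts-agree (hit-ord h) b a) n′)

    hit-below : ∀ {x β γ} → Hit x β → γ ∈⁺ β → Σ Dom λ y → Hit y γ
    hit-below h@(_ , f , a , n) p = let ((y , q) , k) = a _ p in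
      y , ord⇒ordinal (ord-element (hit-ord h) p) , f , attempt-below (hit-ord h) p a , k y q

    -- The attempt that reaches `x` at `β` would already have taken `x` at `γ`, yet the choice at
    -- `β` avoids all earlier values.
    hit-≮ : ∀ {x β γ} → Hit x β → Hit x γ → Not (γ ∈⁺ β)
    hit-≮ h@(_ , f , a , n) k@(_ , g , b , n′) p = next-fresh n p
      (attempt-value a p (next-cong (attempts-agree (hit-ord k) b (attempt-below (hit-ord h) p a)) n′))

    hit-ordinal : ∀ {x β γ} → Hit x β → Hit x γ → β ≡ γ
    hit-ordinal h k = [ (λ p → ⊥-elim (hit-≮ k h p)) , [ id , (λ p → ⊥-elim (hit-≮ h k p)) ]′ ]′
      (ord-compare (hit-ord h) (hit-ord k))

    hitElements : Collection (λ x → x ∈⁺ X × Σ Dom λ β → Hit x β)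
    hitElements = collect (v₀ᵉ ∈ᵖ v₁ᵉ ∧ᵖ ∃ᵖ hit) (X ∷ c ∷ []) (X , λ _ → proj₁)

    H : Dom
    H = proj₁ hitElements

    ∈H : ∀ x → x ∈⁺ H ↔ (x ∈⁺ X × Σ Dom λ β → Hit x β)
    ∈H x = proj₁ (proj₂ hitElements x)

    -- Replacement runs from elements to ordinals: `H` is known to be a set, and an element is hit
    -- at one ordinal only.
    hitOrdinals : Collection (λ β → Σ Dom λ x → x ∈⁺ H × Hit x β)
    hitOrdinals = replace hit (X ∷ c ∷ []) (collection-classical (proj₂ hitElements)) λ x p →
      let (β , h) = proj₂ (proj₁ (∈H x) p)
      in β , λ γ → (λ k → hit-ordinal k h) , λ { refl → h }

    O : Dom
    O = proj₁ hitOrdinals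

    ∈O : ∀ β → β ∈⁺ O ↔ Σ Dom λ x → Hit x β
    ∈O β = ↔-trans (proj₁ (proj₂ hitOrdinals β))
      ((λ (x , _ , h) → x , h) , (λ (x , h) → x , proj₂ (∈H x) (hit-∈ h , β , h) , h))

    O-ord : Ord O
    O-ord = ord-from-elements (collection-classical (proj₂ hitOrdinals))
      (λ p q → let (_ , h) = proj₁ (∈O _) q in proj₂ (∈O _) (hit-below h p))
      (λ β q → hit-ord (proj₂ (proj₁ (∈O β) q)))

    enumeration : Collection (λ z → Σ Dom λ x → Σ Dom λ β → z ≡ pairᴰ β x × Hit x β)
    enumeration = collect (∃ᵖ (∃ᵖ (v₂ᵉ ≐ᵖ pairᵉ v₀ᵉ v₁ᵉ ∧ᵖ wk₂ᵖ hit))) (X ∷ c ∷ [])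
      (bounded-mono
        (λ z (x , β , e , h) → β , x , e , proj₂ (∈O β) (x , h) , hit-∈ h)
        (bounded-pairs (O , λ _ → id) (X , λ _ → id)))

    E : Dom
    E = proj₁ enumeration

    ∈E : ∀ β x → pairᴰ β x ∈⁺ E ↔ Hit x β
    ∈E β x = ↔-trans (proj₁ (proj₂ enumeration _))
      ( (λ (x′ , β′ , e , h) → let (eβ , ex) = pair-injective e in
          subst (λ x → Hit x β) (sym ex) (subst (Hit x′) (sym eβ) h))
      , (λ h → x , β , refl , h))

    -- Below `β`, the union of all attempts agrees with the single attempt that witnesses the hit at
    -- `β`, and `Next` depends on nothing but the values below `β`.
    E-attempt : Attempt E O
    E-attempt β p = let (x , h) = proj₁ (∈O β) p in (x , proj₂ (∈E β x) h) , λ y q → next (proj₁ (∈E β y) q)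
      where
      next : ∀ {y} → Hit y β → Next E β y
      next h@(_ , f , a , n) = next-cong (λ γ q x →
          (λ r → proj₂ (∈E γ x)
             ( ord⇒ordinal (ord-element (hit-ord h) q) , f , attempt-below (hit-ord h) q a , proj₂ (a γ q) x r))
        , (λ r → let k@(_ , g , b , n′) = proj₁ (∈E γ x) r in
             attempt-value a q (next-cong (attempts-agree (hit-ord k) b (attempt-below (hit-ord h) q a)) n′))) n

    -- Otherwise the element chosen from X ∖ H would be hit at O, whence O ∈ O.
    all-hit : ∀ x → x ∈⁺ X → x ∈⁺ H
    all-hit x p = by-contradiction λ x∉H → absurd
      (chooses complement-classical (λ y r → proj₁ (proj₁ (complement y) r)) (proj₂ (complement x) (p , x∉H)))
      where
      H-classical : Classical⁺ H
      H-classical = collection-classical (proj₂ hitElements)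

      complement-classical : Classical⁺ (X ∖ᴰ H)
      complement-classical = ∖-classical cX H-classical

      complement : ∀ x → x ∈⁺ X ∖ᴰ H ↔ (x ∈⁺ X × Not (x ∈⁺ H))
      complement x = ↔-trans (∈∖ X H x) (×-cong (id , id) (∈⁻↔Not H-classical x))

      hit-enumerated : ∀ x → x ∈⁺ H ↔ Σ Dom λ γ → γ ∈⁺ O × pairᴰ γ x ∈⁺ E
      hit-enumerated x =
          (λ r → let (β , h) = proj₂ (proj₁ (∈H x) r) in β , proj₂ (∈O β) (x , h) , proj₂ (∈E β x) h)
        , (λ (β , _ , r) → let h = proj₁ (∈E β x) r in proj₂ (∈H x) (hit-∈ h , β , h))

      absurd : Not (Σ Dom λ y → pairᴰ (X ∖ᴰ H) y ∈⁺ c)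
      absurd (y , q) = ord-irrefl O-ord (proj₂ (∈O O) (y , ord⇒ordinal O-ord , E , E-attempt ,
        X ∖ᴰ H , complement-classical ,
        (λ x → ↔-trans (complement x) (×-cong (id , id) (Not-cong (hit-enumerated x)))) , q))

    X≅O : Iso X O
    X≅O = iso hit (X ∷ c ∷ []) record
      { live       = λ h → inj₁ (hit-∈ h)
      ; status     = λ h → members-sameStatus cX (is-classical O-ord) (hit-∈ h) (proj₂ (∈O _) (_ , h))
      ; total      = λ l → proj₂ (proj₁ (∈H _) (all-hit _ (live⇒∈ cX l)))
      ; onto       = λ l → proj₁ (∈O _) (live⇒∈ (is-classical O-ord) l)
      ; functional = hit-ordinal
      ; injective  = hit-value
      }

  well-ordering : ∀ {X} → Classical⁺ X → Σ Dom λ α → Ord α × Iso X α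
  well-ordering cX = O , O-ord , X≅O
    where open WellOrdering cX (proj₂ (choiceFunction cX))

  -- Cardinal numbers

  CardinalOf : Dom → Dom → Set ℓ
  CardinalOf X κ = Ord κ × Iso X κ × (∀ β → Ord β → Iso X β → κ ∈⁺ β ⊎ κ ≡ β)

  cardinalOf-unique : ∀ {X κ μ} → CardinalOf X κ → CardinalOf X μ → κ ≡ μ
  cardinalOf-unique (oκ , i , h) (oμ , j , k) with h _ oμ j | k _ oκ i
  ... | inj₂ p | _      = p
  ... | _      | inj₂ q = sym q
  ... | inj₁ p | inj₁ q = ⊥-elim (ord-irrefl oκ (∈-elements oκ p q))

  cardinalOf-resp : ∀ {X Y κ} → Iso X Y → CardinalOf X κ → CardinalOf Y κ
  cardinalOf-resp i (o , j , h) = o , iso-trans (iso-sym i) j , λ β oβ k → h β oβ (iso-trans i k)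

  leastᵖ : {t : Term n} → Expr t → Pred ∣ t ∣Cl
  leastᵖ e = let p = ordinalᵖ v₀ᵉ ∧ᵖ wk e ≈ᵖ v₀ᵉ
                   ∧ᵖ ∀ᵖ (ordinalᵖ v₀ᵉ ∧ᵖ wk (wk e) ≈ᵖ v₀ᵉ ⟶ᵖ v₁ᵉ ∈ᵖ v₀ᵉ ∨ᵖ v₁ᵉ ≐ᵖ v₀ᵉ)
             in p

  Least : Dom → Dom → Set ℓ
  Least X κ = T (ordinalᵖ v₀ᵉ) (κ ∷ []) × Equinumerous X κ
    × (∀ β → T (ordinalᵖ v₀ᵉ) (β ∷ []) × Equinumerous X β → κ ∈⁺ β ⊎ κ ≡ β)

  least↔cardinalOf : ∀ {X κ} → Classical⁺ X → Least X κ ↔ CardinalOf X κ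
  least↔cardinalOf c =
      (λ (o , e , h) → let oκ = ordinal⇒ord o in
         oκ , equinumerous⇒iso c (is-classical oκ) e ,
         λ β oβ i → h β (ord⇒ordinal oβ , iso⇒equinumerous c (is-classical oβ) i))
    , (λ (o , i , h) →
         ord⇒ordinal o , iso⇒equinumerous c (is-classical o) i ,
         λ β (oβ , e) → let oβ′ = ordinal⇒ord oβ in h β oβ′ (equinumerous⇒iso c (is-classical oβ′) e))

  opaque

    cardinality : ∀ {X} → Classical⁺ X → Σ Dom (CardinalOf X)
    cardinality {X} c =
      let (α , o , i) = well-ordering c
          (κ , oκ , e , h) = least i o
      in κ , oκ , equinumerous⇒iso c (is-classical oκ) e
           , λ β oβ j → h β oβ (iso⇒equinumerous c (is-classical oβ) j)
      where
      least : ∀ {α} → Iso X α → Ord α → Σ Dom λ κ → Ord κ × Equinumerous X κ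
        × (∀ β → Ord β → Equinumerous X β → κ ∈⁺ β ⊎ κ ≡ β)
      least i o = least-ordinal (v₁ᵉ ≈ᵖ v₀ᵉ) (X ∷ []) o (iso⇒equinumerous c (is-classical o) i)

  card : ∀ {X} → Classical⁺ X → Dom
  card c = proj₁ (cardinality c)

  opaque
    card-classical : ∀ {X} (c : Classical⁺ X) → Classical⁺ (card c)
    card-classical c = is-classical (proj₁ (proj₂ (cardinality c)))

  card-≡⇒iso : ∀ {X Y} {cX : Classical⁺ X} {cY : Classical⁺ Y} → card cX ≡ card cY → Iso X Y
  card-≡⇒iso {X} {cX = cX} {cY} e = iso-trans
    (subst (Iso X) e (proj₁ (proj₂ (proj₂ (cardinality cX)))))
    (iso-sym (proj₁ (proj₂ (proj₂ (cardinality cY)))))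

  iso⇒card-≡ : ∀ {X Y} {cX : Classical⁺ X} {cY : Classical⁺ Y} → Iso X Y → card cX ≡ card cY
  iso⇒card-≡ {cX = cX} {cY} i =
    cardinalOf-unique (cardinalOf-resp i (proj₂ (cardinality cX))) (proj₂ (cardinality cY))

  cardᵉ : (e : Expr t) (c : ∀ ρ → Classical⁺ (val e ρ)) → Expr ∣ t ∣Cl
  cardᵉ e c = expr (λ ρ → card (c ρ)) λ ρ κ →
    ↔-trans (T↔ (leastᵖ e) (κ ∷ ρ)) (↔-trans (least↔cardinalOf (c ρ))
      ((λ h → cardinalOf-unique h (proj₂ (cardinality (c ρ)))) , λ { refl → proj₂ (cardinality (c ρ)) }))

  -- Gluts, gaps and the cardinal of a set as a function.

  acla-axiom :
    (Σ Dom λ A → Σ Dom λ x → (x ∈⁺ A !ᴰ × x ∈⁻ A ?ᴰ) ⊎ (x ∈⁻ A ?ᴰ × x ∈⁺ A !ᴰ)) ×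
    (Σ Dom λ A → Σ Dom λ x → (x ∈⁺ A ?ᴰ × x ∈⁻ A !ᴰ) ⊎ (x ∈⁻ A !ᴰ × x ∈⁺ A ?ᴰ))
  acla-axiom = satisfied (∃ᵖ (∼ᵖ (v₀ᵉ !ᵉ ⊆ᵖ v₀ᵉ ?ᵉ)) ∧ᵖ ∃ᵖ (∼ᵖ (v₀ᵉ ?ᵉ ⊆ᵖ v₀ᵉ !ᵉ))) acla

  -- The two halves of `⇒` are falsified in the same way, by a true premise with a false conclusion,
  -- so a failed inclusion offers the same two facts in either order.
  ×-from-⊎ : {P Q : Set ℓ} → (P × Q) ⊎ (Q × P) → P × Q
  ×-from-⊎ (inj₁ (p , q)) = p , q
  ×-from-⊎ (inj₂ (q , p)) = p , q

  -- The atomic formula obtained here, like the one from `gap`, acts as a constant truth value once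
  -- its two sets are passed as parameters.
  glut : Σ Dom λ A → Σ Dom λ a → a ∈⁺ A × a ∈⁻ A
  glut = let (A , a , h) = proj₁ acla-axiom ; (p , q) = ×-from-⊎ h in
    A , a , proj₁ (∈! A a) p , proj₁ (proj₂ (proj₂ (possibles A) a)) q

  gap : Σ Dom λ B → Σ Dom λ b → Not (b ∈⁻ B) × Not (b ∈⁺ B)
  gap = let (B , b , h) = proj₂ acla-axiom ; (p , q) = ×-from-⊎ h in
    B , b , proj₁ (∈? B b) p , proj₁ (proj₂ (proj₂ (truths B) b)) q

  opaque

    -- With b both true and false and n neither, (x ∈ X ∧ (x ∈ Y ∨ b)) ∨ (x ∈ Y ∧ n)
    -- is true iff x ∈ X, and false iff x ∉ Y.
    angle : ∀ {X Y} → Classical⁺ X → Classical⁺ Y → Set⟨ (λ x → x ∈⁺ X) , (λ x → Not (x ∈⁺ Y)) ⟩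
    angle {X} {Y} cX cY = build glut gap
      where
      build : (Σ Dom λ A → Σ Dom λ a → a ∈⁺ A × a ∈⁻ A) →
        (Σ Dom λ B → Σ Dom λ b → Not (b ∈⁻ B) × Not (b ∈⁺ B)) →
        Set⟨ (λ x → x ∈⁺ X) , (λ x → Not (x ∈⁺ Y)) ⟩
      build (A , a , a∈A , a∉A) (B , b , ¬b∉B , ¬b∈B) = proj₁ set , λ x →
          ↔-trans (proj₁ (proj₂ set x))
            ( [ proj₁ , (λ (_ , t) → ⊥-elim (¬b∈B t)) ]′
            , (λ p → inj₁ (p , inj₂ a∈A)))
        , ↔-trans (proj₂ (proj₂ set x))
            ( (λ (_ , h) → [ proj₁ (∈⁻↔Not cY x) , (λ f → ⊥-elim (¬b∉B f)) ]′ h)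
            , (λ q → let y = proj₂ (∈⁻↔Not cY x) q in inj₂ (y , a∉A) , inj₁ y))
        where
        Truth Falsity : Dom → Set ℓ
        Truth x = (x ∈⁺ X × (x ∈⁺ Y ⊎ a ∈⁺ A)) ⊎ (x ∈⁺ Y × b ∈⁺ B)
        Falsity x = (x ∈⁻ X ⊎ (x ∈⁻ Y × a ∈⁻ A)) × (x ∈⁻ Y ⊎ b ∈⁻ B)

        bound : Bounded (λ x → Truth x ⊎ Not (Falsity x))
        bound = X ∪ᴰ Y , λ where
          x (inj₁ (inj₁ (p , _))) → proj₂ (∈∪ X Y x) (inj₁ p)
          x (inj₁ (inj₂ (p , _))) → proj₂ (∈∪ X Y x) (inj₂ p)
          x (inj₂ ¬f) → by-contradiction λ h →
            ¬f ( inj₁ (proj₂ (∈⁻↔Not cX x) λ p → h (proj₂ (∈∪ X Y x) (inj₁ p)))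
               , inj₁ (proj₂ (∈⁻↔Not cY x) λ p → h (proj₂ (∈∪ X Y x) (inj₂ p))))

        set : Set⟨ Truth , Falsity ⟩
        set = comprehend
          ((v₀ᵉ ∈ᵖ v₁ᵉ ∧ᵖ (v₀ᵉ ∈ᵖ v₂ᵉ ∨ᵖ v₃ᵉ ∈ᵖ v₄ᵉ)) ∨ᵖ (v₀ᵉ ∈ᵖ v₂ᵉ ∧ᵖ var 5F ∈ᵖ var 6F))
          (X ∷ Y ∷ a ∷ A ∷ b ∷ B ∷ []) bound

  angle! : ∀ {X Y} (cX : Classical⁺ X) (cY : Classical⁺ Y) → proj₁ (angle cX cY) !ᴰ ≡ X
  angle! cX cY = classical-ext (!-classical _) cX λ x → ↔-trans (∈! _ x) (proj₁ (proj₂ (angle cX cY) x))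

  angle? : ∀ {X Y} (cX : Classical⁺ X) (cY : Classical⁺ Y) → proj₁ (angle cX cY) ?ᴰ ≡ Y
  angle? cX cY = classical-ext (?-classical _) cY λ x →
    ↔-trans (∈? _ x) (↔-trans (Not-cong (proj₂ (proj₂ (angle cX cY) x))) (by-contradiction , λ p ¬p → ¬p p))

  !?-ext : ∀ {A B} → A !ᴰ ≡ B !ᴰ → A ?ᴰ ≡ B ?ᴰ → A ≡ B
  !?-ext {A} {B} e f = ext
    (λ x → ↔-trans (↔-sym (∈! A x)) (↔-trans (subst (x ∈⁺_) e , subst (x ∈⁺_) (sym e)) (∈! B x)))
    (λ x → ↔-trans (↔-sym (proj₂ (proj₂ (possibles A) x)))
      (↔-trans (subst (x ∈⁻_) f , subst (x ∈⁻_) (sym f)) (proj₂ (proj₂ (possibles B) x))))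

  angleᵉ : {s t : Term n} (d : Expr s) (e : Expr t) →
    (∀ ρ → Classical⁺ (val d ρ)) → (∀ ρ → Classical⁺ (val e ρ)) → Expr ⟨ s ¦ t ⟩
  angleᵉ d e c c′ = expr (λ ρ → proj₁ (angle (c ρ) (c′ ρ))) λ ρ A →
    ↔-trans (T↔ (v₀ᵉ !ᵉ ≐ᵖ wk d ∧ᵖ v₀ᵉ ?ᵉ ≐ᵖ wk e) (A ∷ ρ))
      ( (λ (p , q) → !?-ext (trans p (sym (angle! (c ρ) (c′ ρ)))) (trans q (sym (angle? (c ρ) (c′ ρ)))))
      , λ { refl → angle! (c ρ) (c′ ρ) , angle? (c ρ) (c′ ρ) })

  angle-cong : ∀ {X Y X′ Y′} {cX : Classical⁺ X} {cY : Classical⁺ Y}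
    {cX′ : Classical⁺ X′} {cY′ : Classical⁺ Y′} →
    X ≡ X′ → Y ≡ Y′ → proj₁ (angle cX cY) ≡ proj₁ (angle cX′ cY′)
  angle-cong {cX = cX} {cY} {cX′} {cY′} e f = !?-ext
    (trans (angle! cX cY) (trans e (sym (angle! cX′ cY′))))
    (trans (angle? cX cY) (trans f (sym (angle? cX′ cY′))))

  angle-injective : ∀ {X Y X′ Y′} {cX : Classical⁺ X} {cY : Classical⁺ Y}
    {cX′ : Classical⁺ X′} {cY′ : Classical⁺ Y′} →
    proj₁ (angle cX cY) ≡ proj₁ (angle cX′ cY′) → X ≡ X′ × Y ≡ Y′
  angle-injective {cX = cX} {cY} {cX′} {cY′} e =
    trans (sym (angle! cX cY)) (trans (cong _!ᴰ e) (angle! cX′ cY′)) ,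
    trans (sym (angle? cX cY)) (trans (cong _?ᴰ e) (angle? cX′ cY′))

  cardinal : Dom → Dom
  cardinal A = pairᴰ (proj₁ (angle (c (!-classical A)) (c (?-classical A))))
              (pairᴰ (proj₁ (angle (c (part-classical true {A})) (c (?-classical A))))
                     (proj₁ (angle (c (part-classical both {A})) (c (part-classical neither {A})))))
    where c = card-classical

  trueᵉ : Expr t → Expr (t ᵗ)
  trueᵉ e = let r = e !ᵉ ∩ᵉ e ?ᵉ in r

  bothᵉ : Expr t → Expr (t ᵇ)
  bothᵉ e = let r = e !ᵉ ∖ᵉ e ?ᵉ in r

  neitherᵉ : Expr t → Expr (t ⁿ)
  neitherᵉ e = let r = e ?ᵉ ∖ᵉ e !ᵉ in r

  cardinalᵉ : Expr t → Expr ∣ t ∣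
  cardinalᵉ e = let r = pairᵉ (angleᵉ |!| |?| (λ _ → card-classical _) (λ _ → card-classical _))
                       (pairᵉ (angleᵉ |t| |?| (λ _ → card-classical _) (λ _ → card-classical _))
                              (angleᵉ |b| |n| (λ _ → card-classical _) (λ _ → card-classical _)))
                in r
    where
    |!| = cardᵉ (e !ᵉ) λ _ → !-classical _
    |?| = cardᵉ (e ?ᵉ) λ _ → ?-classical _
    |t| = cardᵉ (trueᵉ e) λ ρ → part-classical true {val e ρ}
    |b| = cardᵉ (bothᵉ e) λ ρ → part-classical both {val e ρ}
    |n| = cardᵉ (neitherᵉ e) λ ρ → part-classical neither {val e ρ}

  -- Cardinal arithmetic and the decomposition

  -- The second entry of the triple reveals the size of the "true" part, the third those of the
  -- "both" and "neither" parts; three bijections of parts then glue.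
  cardinal-≡⇒iso : ∀ {A B} → cardinal A ≡ cardinal B → Iso A B
  cardinal-≡⇒iso e =
    let (_ , e′) = pair-injective e
        (y , z)  = pair-injective e′
    in iso-from-parts λ where
      true    → card-≡⇒iso (proj₁ (angle-injective y))
      both    → card-≡⇒iso (proj₁ (angle-injective z))
      neither → card-≡⇒iso (proj₂ (angle-injective z))

  iso⇒cardinal-≡ : ∀ {A B} → Iso A B → cardinal A ≡ cardinal B
  iso⇒cardinal-≡ {A} {B} i = cong₂ pairᴰ (angle-cong (iso⇒card-≡ truths-iso) (iso⇒card-≡ possibles-iso))
    (cong₂ pairᴰ (angle-cong (iso⇒card-≡ (iso-parts i true)) (iso⇒card-≡ possibles-iso))
                 (angle-cong (iso⇒card-≡ (iso-parts i both)) (iso⇒card-≡ (iso-parts i neither))))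
    where
    truths-iso : Iso (A !ᴰ) (B !ᴰ)
    truths-iso = iso-restrict i (!-classical A) (!-classical B)
      (λ x p → inj₁ (proj₁ (∈! A x) p)) (λ y p → inj₁ (proj₁ (∈! B y) p))
      (λ (p , _) → ↔-trans (∈! A _) (↔-trans p (↔-sym (∈! B _))))
    possibles-iso : Iso (A ?ᴰ) (B ?ᴰ)
    possibles-iso = iso-restrict i (?-classical A) (?-classical B)
      (λ x p → inj₂ (proj₁ (∈? A x) p)) (λ y p → inj₂ (proj₁ (∈? B y) p))
      (λ (_ , q) → ↔-trans (∈? A _) (↔-trans (Not-cong q) (↔-sym (∈? B _))))

  -- κ ⊕ ν and κ ⊙ ν have a value only if κ and ν are cardinals of some sets.
  record CardinalExpr (t : Term n) : Set (lsuc ℓ) where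
    no-eta-equality
    pattern
    constructor cardinalExpr
    field
      value          : Expr t
      representative : Vec Dom n → Dom
      represents     : ∀ ρ → val value ρ ≡ cardinal (representative ρ)

  open CardinalExpr

  infixl 10 _⊕ᵉ_
  infixl 11 _⊙ᵉ_

  ∣_∣ᵉ : Expr t → CardinalExpr ∣ t ∣
  ∣ e ∣ᵉ = let r = cardinalᵉ e in cardinalExpr r (val e) (λ _ → refl)

  -- Independence of representatives: any others are isomorphic to `A` and `B`, because they have
  -- the same cardinals, so their combination has the same cardinal too.
  represented : (_·_ : Dom → Dom → Dom) →
    (∀ {A A′ B B′} → Iso A A′ → Iso B B′ → Iso (A · B) (A′ · B′)) →
    ∀ A B {κ μ ν} → κ ≡ cardinal A → μ ≡ cardinal B →
    (Σ Dom λ A′ → Σ Dom λ B′ → κ ≡ cardinal A′ × μ ≡ cardinal B′ × ν ≡ cardinal (A′ · B′))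
      ↔ ν ≡ cardinal (A · B)
  represented _·_ cong-· A B κ≡ μ≡ =
      (λ (A′ , B′ , p , q , r) → trans r (iso⇒cardinal-≡
         (cong-· (cardinal-≡⇒iso (trans (sym p) κ≡)) (cardinal-≡⇒iso (trans (sym q) μ≡)))))
    , (λ r → A , B , κ≡ , μ≡ , r)

  _⊕ᵉ_ : CardinalExpr s → CardinalExpr t → CardinalExpr (s ⊕ t)
  cardinalExpr d A dA ⊕ᵉ cardinalExpr e B eB =
    let p = ∃ᵖ (∃ᵖ (  wk (wk (wk d)) ≐ᵖ cardinalᵉ v₁ᵉ
                   ∧ᵖ wk (wk (wk e)) ≐ᵖ cardinalᵉ v₀ᵉ
                   ∧ᵖ v₂ᵉ ≐ᵖ cardinalᵉ (v₁ᵉ ⊎ᵉ v₀ᵉ)))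
        r = expr (λ ρ → cardinal (A ρ ⊎ᴰ B ρ)) λ ρ κ →
              ↔-trans (T↔ p (κ ∷ ρ)) (represented _⊎ᴰ_ iso-⊎ (A ρ) (B ρ) (dA ρ) (eB ρ))
    in cardinalExpr r (λ ρ → A ρ ⊎ᴰ B ρ) (λ _ → refl)

  _⊙ᵉ_ : CardinalExpr s → CardinalExpr t → CardinalExpr (s ⊙ t)
  cardinalExpr d A dA ⊙ᵉ cardinalExpr e B eB =
    let p = ∃ᵖ (∃ᵖ (  wk (wk (wk d)) ≐ᵖ cardinalᵉ v₁ᵉ
                   ∧ᵖ wk (wk (wk e)) ≐ᵖ cardinalᵉ v₀ᵉ
                   ∧ᵖ v₂ᵉ ≐ᵖ cardinalᵉ (v₁ᵉ ⊗ᵉ v₀ᵉ)))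
        r = expr (λ ρ → cardinal (A ρ ⊗ᴰ B ρ)) λ ρ κ →
              ↔-trans (T↔ p (κ ∷ ρ)) (represented _⊗ᴰ_ iso-⊗ (A ρ) (B ρ) (dA ρ) (eB ρ))
    in cardinalExpr r (λ ρ → A ρ ⊗ᴰ B ρ) (λ _ → refl)

  -- The units, and reassembling a set from its parts.

  unitᴮ unitᴺ : Dom
  -- The empty set is among the truths without being a possible element, hence both; in `unitᴺ` it
  -- is possible without being among the truths, hence neither.
  unitᴮ = proj₁ (angle (sing-classical ∅ᴰ) ∅-classical)
  unitᴺ = proj₁ (angle ∅-classical (sing-classical ∅ᴰ))

  ∈⁺unitᴮ : ∀ {x} → x ∈⁺ unitᴮ ↔ x ≡ ∅ᴰ
  ∈⁺unitᴮ = ↔-trans (proj₁ (proj₂ (angle _ _) _)) (∈sing ∅ᴰ _)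

  ∈⁻unitᴮ : ∀ {x} → x ∈⁻ unitᴮ
  ∈⁻unitᴮ = proj₂ (proj₂ (proj₂ (angle _ _) _)) ∉∅

  ∉⁺unitᴺ : ∀ {x} → Not (x ∈⁺ unitᴺ)
  ∉⁺unitᴺ p = ∉∅ (proj₁ (proj₁ (proj₂ (angle _ _) _)) p)

  ∈⁻unitᴺ : ∀ {x} → x ∈⁻ unitᴺ ↔ Not (x ≡ ∅ᴰ)
  ∈⁻unitᴺ = ↔-trans (proj₂ (proj₂ (angle _ _) _)) (Not-cong (∈sing ∅ᴰ _))

  -- An element outside the realm has no `Status`; the hypothesis then puts it outside both realms,
  -- so it is plainly false in `A` and in `B`.
  sameStatus : ∀ {x A B} → (∀ s → HasStatus s x A ↔ HasStatus s x B) → SameStatus x A x B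
  sameStatus {x} {A} {B} e with split (Live x A)
  ... | inj₁ l = let (s , h) = live-status l in hasStatus-same s h (proj₁ (e s) h)
  ... | inj₂ ¬l =
      ((λ p → ⊥-elim (¬l (inj₁ p))) , λ p → ⊥-elim (¬l′ (inj₁ p)))
    , ((λ _ → by-contradiction λ ¬q → ¬l′ (inj₂ ¬q)) , λ _ → by-contradiction λ ¬q → ¬l (inj₂ ¬q))
    where
    ¬l′ : Not (Live x B)
    ¬l′ l = let (s , h) = live-status l in ¬l (status-live s (proj₂ (e s) h))

  parts-determine : ∀ {A B} → (∀ s → part s A ≡ part s B) → A ≡ B
  parts-determine {A} {B} e = ext (λ x → proj₁ (same x)) (λ x → proj₂ (same x))
    where
    same : ∀ x → SameStatus x A x B
    same x = sameStatus λ s → ↔-trans (↔-sym (part-member s))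
      (↔-trans (subst (x ∈⁺_) (e s) , subst (x ∈⁺_) (sym (e s))) (part-member s))

  angle₃ᵉ : {r s t : Term n} (b : Expr r) (d : Expr s) (e : Expr t) (f : Vec Dom n → Dom) →
    (∀ ρ → part both (f ρ) ≡ val b ρ × part true (f ρ) ≡ val d ρ × part neither (f ρ) ≡ val e ρ) →
    Expr ⟨ r ¦ s ¦ t ⟩
  angle₃ᵉ b d e f h = expr f λ ρ A →
    ↔-trans (T↔ (bothᵉ v₀ᵉ ≐ᵖ wk b ∧ᵖ trueᵉ v₀ᵉ ≐ᵖ wk d ∧ᵖ neitherᵉ v₀ᵉ ≐ᵖ wk e) (A ∷ ρ))
      ( (λ (p , q , r) → let (p′ , q′ , r′) = h ρ in parts-determine λ where
           true    → trans q (sym q′)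
           both    → trans p (sym p′)
           neither → trans r (sym r′))
      , λ { refl → h ρ })

  part-≡ : ∀ s {A X} → Classical⁺ X → (∀ x → HasStatus s x A ↔ x ∈⁺ X) → part s A ≡ X
  part-≡ s c e = classical-ext (part-classical s) c λ x → ↔-trans (part-member s) (e x)

  unitᴮᵉ : Expr {n} ⟨ sing ∅ ¦ ∅ ¦ ∅ ⟩
  unitᴮᵉ = let r = angle₃ᵉ (singᵉ ∅ᵉ) ∅ᵉ ∅ᵉ (λ _ → unitᴮ) λ _ →
                   part-≡ both (sing-classical ∅ᴰ) (λ x →
                     (λ (p , _) → proj₂ (∈sing ∅ᴰ x) (proj₁ ∈⁺unitᴮ p)) ,
                     (λ p → proj₂ ∈⁺unitᴮ (proj₁ (∈sing ∅ᴰ x) p) , ∈⁻unitᴮ))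
                 , part-≡ true ∅-classical (λ x → (λ (_ , ¬q) → ⊥-elim (¬q ∈⁻unitᴮ)) , (λ p → ⊥-elim (∉∅ p)))
                 , part-≡ neither ∅-classical (λ x → (λ (¬q , _) → ⊥-elim (¬q ∈⁻unitᴮ)) , (λ p → ⊥-elim (∉∅ p)))
           in r

  𝔟ᵉ : CardinalExpr {n} 𝔟
  𝔟ᵉ = let r = ∣ unitᴮᵉ ∣ᵉ in r

  unitᴺᵉ : Expr {n} ⟨ ∅ ¦ ∅ ¦ sing ∅ ⟩
  unitᴺᵉ = let r = angle₃ᵉ ∅ᵉ ∅ᵉ (singᵉ ∅ᵉ) (λ _ → unitᴺ) λ _ →
                   part-≡ both ∅-classical (λ x → (λ (p , _) → ⊥-elim (∉⁺unitᴺ p)) , (λ p → ⊥-elim (∉∅ p)))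
                 , part-≡ true ∅-classical (λ x → (λ (p , _) → ⊥-elim (∉⁺unitᴺ p)) , (λ p → ⊥-elim (∉∅ p)))
                 , part-≡ neither (sing-classical ∅ᴰ) (λ x →
                     (λ (¬q , _) → proj₂ (∈sing ∅ᴰ x) (by-contradiction λ ¬p → ¬q (proj₂ ∈⁻unitᴺ ¬p))) ,
                     (λ p → (λ q → proj₁ ∈⁻unitᴺ q (proj₁ (∈sing ∅ᴰ x) p)) , ∉⁺unitᴺ))
           in r

  𝔫ᵉ : CardinalExpr {n} 𝔫
  𝔫ᵉ = let r = ∣ unitᴺᵉ ∣ᵉ in r

  -- Where x ∈ A of the given status ends up in (A_t ⊎ A_b × 𝔟) ⊎ A_n × 𝔫.
  encode : Status → Dom → Dom
  encode true    x = pairᴰ (pairᴰ x 0ᴰ) 0ᴰ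
  encode both    x = pairᴰ (pairᴰ (pairᴰ x ∅ᴰ) 1ᴰ) 0ᴰ
  encode neither x = pairᴰ (pairᴰ x ∅ᴰ) 1ᴰ

  encode-injective : ∀ s s′ {x x′} → encode s x ≡ encode s′ x′ → x ≡ x′
  encode-injective true    true    e = proj₁ (pair-injective (proj₁ (pair-injective e)))
  encode-injective true    both    e = ⊥-elim (0≢1 (proj₂ (pair-injective (proj₁ (pair-injective e)))))
  encode-injective true    neither e = ⊥-elim (0≢1 (proj₂ (pair-injective e)))
  encode-injective both    true    e = ⊥-elim (0≢1 (sym (proj₂ (pair-injective (proj₁ (pair-injective e))))))
  encode-injective both    both    e =
    proj₁ (pair-injective (proj₁ (pair-injective (proj₁ (pair-injective e)))))
  encode-injective both    neither e = ⊥-elim (0≢1 (proj₂ (pair-injective e)))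
  encode-injective neither true    e = ⊥-elim (0≢1 (sym (proj₂ (pair-injective e))))
  encode-injective neither both    e = ⊥-elim (0≢1 (sym (proj₂ (pair-injective e))))
  encode-injective neither neither e = proj₁ (pair-injective (proj₁ (pair-injective e)))

  recomposition : Dom → Dom
  recomposition A = part true A ⊎ᴰ part both A ⊗ᴰ unitᴮ ⊎ᴰ part neither A ⊗ᴰ unitᴺ

  encode-status : ∀ s {x A} → x ∈⁺ part s A → HasStatus s (encode s x) (recomposition A)
  encode-status true p =
      proj₂ ∈⁺⊎₀ (proj₂ ∈⁺⊎₀ p)
    , λ q → proj₁ (part-classical true _) p (proj₁ ∈⁻⊎₀ (proj₁ ∈⁻⊎₀ q))
  encode-status both p =
      proj₂ ∈⁺⊎₀ (proj₂ ∈⁺⊎₁ (proj₂ ∈⊗ (p , proj₂ ∈⁺unitᴮ refl)))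
    , proj₂ ∈⁻⊎₀ (proj₂ ∈⁻⊎₁ (proj₂ ∈⁻⊗ (inj₂ ∈⁻unitᴮ)))
  encode-status neither p =
      (λ q → [ proj₁ (part-classical neither _) p , (λ r → proj₁ ∈⁻unitᴺ r refl) ]′
               (proj₁ ∈⁻⊗ (proj₁ ∈⁻⊎₁ q)))
    , (λ q → ∉⁺unitᴺ (proj₂ (proj₁ ∈⊗ (proj₁ ∈⁺⊎₁ q))))

  live-unitᴮ : ∀ {x} → Live x unitᴮ → x ≡ ∅ᴰ
  live-unitᴮ (inj₁ p)  = proj₁ ∈⁺unitᴮ p
  live-unitᴮ (inj₂ ¬q) = ⊥-elim (¬q ∈⁻unitᴮ)

  live-unitᴺ : ∀ {x} → Live x unitᴺ → x ≡ ∅ᴰ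
  live-unitᴺ (inj₁ p)  = ⊥-elim (∉⁺unitᴺ p)
  live-unitᴺ (inj₂ ¬q) = by-contradiction λ ¬p → ¬q (proj₂ ∈⁻unitᴺ ¬p)

  -- Liveness passes from a sum to the summand and from a pair to both entries, and a live second
  -- entry in a unit can only be the empty set.
  decode : ∀ {z A} → Live z (recomposition A) → Σ Status λ s → Σ Dom λ x → z ≡ encode s x × x ∈⁺ part s A
  decode l with live-⊎ l
  ... | inj₂ (y , refl , k) =
    let (x , _ , e , i , j) = live-⊗ k in
    neither , x , cong (λ y → pairᴰ y 1ᴰ) (trans e (cong (pairᴰ x) (live-unitᴺ j)))
            , live⇒∈ (part-classical neither) i
  ... | inj₁ (_ , refl , k) with live-⊎ k
  ... | inj₁ (x , refl , j) = true , x , refl , live⇒∈ (part-classical true) j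
  ... | inj₂ (y , refl , j) =
    let (x , _ , e , i , j′) = live-⊗ j in
    both , x , cong (λ y → pairᴰ (pairᴰ y 1ᴰ) 0ᴰ) (trans e (cong (pairᴰ x) (live-unitᴮ j′)))
         , live⇒∈ (part-classical both) i

  recomposition-iso : ∀ A → Iso (recomposition A) A
  recomposition-iso A = iso
    (   (v₁ᵉ ≐ᵖ pairᵉ (pairᵉ v₀ᵉ 0ᵉ) 0ᵉ ∧ᵖ v₀ᵉ ∈ᵖ v₂ᵉ)
     ∨ᵖ (v₁ᵉ ≐ᵖ pairᵉ (pairᵉ (pairᵉ v₀ᵉ ∅ᵉ) 1ᵉ) 0ᵉ ∧ᵖ v₀ᵉ ∈ᵖ v₃ᵉ)
     ∨ᵖ (v₁ᵉ ≐ᵖ pairᵉ (pairᵉ v₀ᵉ ∅ᵉ) 1ᵉ ∧ᵖ v₀ᵉ ∈ᵖ v₄ᵉ))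
    (part true A ∷ part both A ∷ part neither A ∷ [])
    (isIso-resp {R = Rel} (λ z x → ∃-status {λ s → z ≡ encode s x × x ∈⁺ part s A}) record
      { live       = λ { (s , refl , p) → status-live s (encode-status s p) }
      ; status     = λ { (s , refl , p) → hasStatus-same s (encode-status s p) (proj₁ (part-member s) p) }
      ; total      = λ l → let (s , x , e , p) = decode l in x , s , e , p
      ; onto       = λ {x} l → let (s , h) = live-status l in encode s x , s , refl , proj₂ (part-member s) h
      ; functional = λ { (s , refl , _) (s′ , e , _) → encode-injective s s′ e }
      ; injective  = λ { {y = x} (s , refl , p) (s′ , refl , p′) → cong (λ s → encode s x)
          (status-unique s s′ (proj₁ (part-member s) p) (proj₁ (part-member s′) p′)) }
      })
    where
    Rel : Dom → Dom → Set ℓ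
    Rel z x = Σ Status λ s → z ≡ encode s x × x ∈⁺ part s A

  -- Equality of the two descriptions.

  same-cardinal : (c : CardinalExpr s) (d : CardinalExpr t) →
    (∀ ρ → Iso (representative c ρ) (representative d ρ)) → ∀ ρ → Semantics.True 𝔐 (s ≗ t) ρ
  same-cardinal c d i ρ = κ , val↔ (wk (value c)) (κ ∷ ρ) ,
    λ x → ↔-trans (val↔ (wk (value d)) (κ ∷ ρ) x) ((λ p → trans p (sym e)) , λ p → trans p e)
    where
    κ : Dom
    κ = val (value c) ρ
    e : κ ≡ val (value d) ρ
    e = trans (represents c ρ) (trans (iso⇒cardinal-≡ (i ρ)) (sym (represents d ρ)))

  recomposedᵉ : {t : Term n} → Expr t → CardinalExpr (∣ t ᵗ ∣ ⊕ ∣ t ᵇ ∣ ⊙ 𝔟 ⊕ ∣ t ⁿ ∣ ⊙ 𝔫)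
  recomposedᵉ e = let r = ∣ trueᵉ e ∣ᵉ ⊕ᵉ ∣ bothᵉ e ∣ᵉ ⊙ᵉ 𝔟ᵉ ⊕ᵉ ∣ neitherᵉ e ∣ᵉ ⊙ᵉ 𝔫ᵉ in r

  decomposition : {t : Term n} → Expr t → ∀ ρ →
    Semantics.True 𝔐 (∣ t ∣ ≗ ∣ t ᵗ ∣ ⊕ ∣ t ᵇ ∣ ⊙ 𝔟 ⊕ ∣ t ⁿ ∣ ⊙ 𝔫) ρ
  decomposition e =
    let r = same-cardinal ∣ e ∣ᵉ (recomposedᵉ e) (λ ρ → iso-sym (recomposition-iso (val e ρ))) in r

  -- The general n and the qualified True keep this statement and its instance at 0
  -- syntactically equal to the theorem; unfolding the formula is infeasible.
  ∀-decomposition : ∀ n (ρ : Vec Dom n) →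
    Semantics.True 𝔐 (∀ᶠ (∣ v₀ ∣ ≗ ∣ v₀ ᵗ ∣ ⊕ ∣ v₀ ᵇ ∣ ⊙ 𝔟 ⊕ ∣ v₀ ⁿ ∣ ⊙ 𝔫)) ρ
  ∀-decomposition n ρ A = decomposition {n = suc n} {t = v₀ {n}} (v₀ᵉ {n}) (A ∷ ρ)

  holds : (φ : Sentence) → (∀ ρ → Semantics.True 𝔐 φ ρ) → 𝔐 ⊩ φ
  holds φ h = h []

theorem5p9 : ∀ {ℓ} → ExcludedMiddle ℓ →
    BZFC ⊨[ ℓ ] ∀ᶠ (∣ v₀ ∣ ≗ ∣ v₀ ᵗ ∣ ⊕ ∣ v₀ ᵇ ∣ ⊙ 𝔟 ⊕ ∣ v₀ ⁿ ∣ ⊙ 𝔫)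
theorem5p9 em 𝔐 ax = holds (∀ᶠ (∣ v₀ ∣ ≗ ∣ v₀ ᵗ ∣ ⊕ ∣ v₀ ᵇ ∣ ⊙ 𝔟 ⊕ ∣ v₀ ⁿ ∣ ⊙ 𝔫)) (∀-decomposition 0)
  where open Theory em 𝔐 ax
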